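{- Let $k$ be a nonnegative integer. Then $${\rm ord}_2(t^o_{4k+1})=k+{\rm ord}_2(k)+\chi_e(k).$$
   Context: $t^o_n$ is the number of involutions of $[n]$ (permutations with $\pi^2=1$) having an odd number of 2-cycles. $\chi_e(k)=1$ if $k$ is even and $0$ otherwise. ${\rm ord}_2(m)$ is the largest integer $e$ with $2^e\mid m$, with the convention ${\rm ord}_2(0)=+\infty$. -}

module Defs where

open import Data.Nat using (ℕ; zero; suc; _+_; _*_; _^_; _<?_; _%_)
open import Data.Nat.Divisibility using (_∣_)
open import Data.Fin using (Fin; toℕ)
open import Data.Fin.Properties using (all?)
open import Data.Fin.Properties using () renaming (_≟_ to _≟ᶠ_)
open import Data.Vec using (Vec; []; _∷_; lookup)
open import Data.List using (List; []; _∷_; length; filter; allFin; concatMap; map)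
open import Data.Product using (_×_)
open import Relation.Nullary using (¬_)
open import Relation.Binary.PropositionalEquality using (_≡_)

allVecs : (m n : ℕ) → List (Vec (Fin n) m)
allVecs zero    n = [] ∷ []
allVecs (suc m) n = concatMap (λ i → map (i ∷_) (allVecs m n)) (allFin n)

-- A map π : [n] → [n] (as the vector of its values) is an involution if π ∘ π = id.
-- (Such a map is automatically a permutation.)
IsInvolution : {n : ℕ} → Vec (Fin n) n → Set
IsInvolution {n} π = (i : Fin n) → lookup π (lookup π i) ≡ i

isInvolution? : {n : ℕ} (π : Vec (Fin n) n) → Relation.Nullary.Dec (IsInvolution π)
isInvolution? π = all? (λ i → lookup π (lookup π i) ≟ᶠ i)

-- Number of 2-cycles of an involution: the number of i with i < π(i)
-- (each 2-cycle (i j), i < j, is counted once, fixed points not at all).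
twoCycles : {n : ℕ} → Vec (Fin n) n → ℕ
twoCycles {n} π = length (filter (λ i → toℕ i <? toℕ (lookup π i)) (allFin n))

involutions : (n : ℕ) → List (Vec (Fin n) n)
involutions n = filter isInvolution? (allVecs n n)

tᵒ : ℕ → ℕ
tᵒ n = length (filter (λ π → twoCycles π % 2 Data.Nat.≟ 1) (involutions n))

χₑ : ℕ → ℕ
χₑ k with k % 2
... | zero  = 1
... | suc _ = 0

data ℕ∞ : Set where
  fin : ℕ → ℕ∞
  ∞   : ℕ∞

_+∞_ : ℕ∞ → ℕ → ℕ∞
fin a +∞ b = fin (a + b)
∞     +∞ b = ∞

-- IsOrd₂ m v : v = ord₂(m), the largest e with 2^e ∣ m, and ord₂(0) = +∞
-- (v = ∞ means every power of 2 divides m, i.e. m = 0).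
IsOrd₂ : ℕ → ℕ∞ → Set
IsOrd₂ m (fin e) = (2 ^ e ∣ m) × ¬ (2 ^ suc e ∣ m)
IsOrd₂ m ∞       = (e : ℕ) → 2 ^ e ∣ m

{-# OPTIONS --safe #-}
module Submission where

-- Let k = m + 1 and i + j = m.  The number of involutions of [4k + 1] with 2j + 1 two-cycles is
--   2k (2m + 1)!! (4m + 5)!! (m choose i) / ((2i + 1)!! (4i + 3)!! (2j + 1)!!),
-- so a factor 2k splits off and, up to odd factors, a binomial sum Q remains.  By Pascal's rule, Q is the
-- value at 0 of an m-fold iteration of maps q(i) ↦ b q(i + 1) + a q(i), with odd-valued polynomials a and b.
-- On functions Σᵣ cᵣ 2ʳ (i choose r) with integral c, such a map is twice an integral operator on c, whence
-- Q = 2ᵐ c₀.  Modulo 4 the operator preserves the sequences supported on r < 4, and two iterations restore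
-- the shape of c: in the end c₀ is odd for m even, and twice an odd number for m odd.

open import Defs
open import Data.Nat as ℕ using (ℕ; zero; suc)
import Data.Nat.Properties as ℕ
import Data.Nat.Divisibility as ℕ
open import Data.Product using (∃; _×_; _,_; proj₁; proj₂)
open import Data.Sum using (_⊎_; inj₁; inj₂; [_,_]′)
open import Function using (_∘_; id; mk⇔)
open import Relation.Nullary using (¬_; does; yes; no; contradiction)
open import Relation.Binary.PropositionalEquality

-- The order cannot be read off term by term: each term of the binomial sum is (m choose i) times an
-- odd number, and the extreme terms are odd, so the power of 2 belongs only to the sum as a whole.
-- The scaling 2ʳ makes it visible: in these coordinates the shift q(i) ↦ q(i + 1) is the identity
-- plus twice an integral operator, so b q(i + 1) + a q(i) is (a + b) q(i) plus an even term, and a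
-- + b is even because a and b are odd. The second variable j disappears because i + j + s = m stays
-- constant, where s counts the iterations; thus m enters the operator as a parameter. Parities of
-- the coefficients settle even m. For odd m the extra factor 2 has to occur exactly once, which is
-- a statement modulo 4. Four coefficients then suffice, because multiplication by 2i carries the
-- factor r at index r: a sequence supported on r < 4 acquires at r = 4 only a multiple of 4.

module Counting where

  open import Data.Nat using (_+_; _*_; _^_; _%_; _<_; _<ᵇ_; _<?_; _≟_; _!; NonZero; s<s⁻¹)
  open import Data.Nat.ListAction using (sum)
  open import Data.Nat.ListAction.Properties using (sum-++; sum-↭)
  open import Data.Nat.Tactic.RingSolver using (solve-∀)
  open import Data.Bool using (if_then_else_; true; false)
  open import Data.Fin using (Fin; zero; suc; toℕ; punchIn; punchOut)
  open import Data.Fin.Properties using (suc-injective; punchIn-injective; punchInᵢ≢i; punchIn-punchOut)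
    renaming (_≟_ to _≟ᶠ_)
  open import Data.Vec using (Vec; []; _∷_; lookup; insertAt)
  import Data.Vec as Vec
  import Data.Vec.Properties as Vec
  open import Data.List using (List; []; _∷_; _++_; length; filter; allFin; map; concatMap; tabulate; cartesianProductWith)
  import Data.List.Properties as List
  open import Data.List.Membership.Propositional using (_∈_)
  open import Data.List.Membership.Propositional.Properties
    using (∈-map⁺; ∈-map⁻; ∈-++⁺ˡ; ∈-++⁺ʳ; ∈-++⁻; ∈-filter⁺; ∈-filter⁻; ∈-allFin;
           ∈-cartesianProductWith⁺; ∈-cartesianProductWith⁻)
  open import Data.List.Membership.Propositional.Properties.WithK using (unique∧set⇒bag)
  open import Data.List.Relation.Binary.BagAndSetEquality using (∼bag⇒↭)
  open import Data.List.Relation.Binary.Permutation.Propositional using (_↭_)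
  open import Data.List.Relation.Binary.Permutation.Propositional.Properties using (map⁺)
  open import Data.List.Relation.Unary.Any using (here)
  open import Data.List.Relation.Unary.All using ([])
  open import Data.List.Relation.Unary.AllPairs using ([]; _∷_)
  open import Data.List.Relation.Unary.Unique.Propositional using (Unique)
  import Data.List.Relation.Unary.Unique.Propositional.Properties as Unique
  open import Relation.Unary using (Pred; Decidable)
  open import Algebra.Properties.CommutativeMonoid.Sum ℕ.+-0-commutativeMonoid
    using (sum-syntax; sum-remove; sum-cong-≗)

  -- Enumeration of involutions without repetition.

  allVecs-product : ∀ m n → allVecs (suc m) n ≡ cartesianProductWith _∷_ (allFin n) (allVecs m n)
  allVecs-product m n = go (allFin n)
    where
    go : (xs : List (Fin n)) →
         concatMap (λ i → map (i ∷_) (allVecs m n)) xs ≡ cartesianProductWith _∷_ xs (allVecs m n)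
    go []       = refl
    go (x ∷ xs) = cong (map (x ∷_) (allVecs m n) ++_) (go xs)

  ∈-allVecs : ∀ {m n} (v : Vec (Fin n) m) → v ∈ allVecs m n
  ∈-allVecs {n = n} []                = here refl
  ∈-allVecs {suc m} {n} (x ∷ v) =
    subst (x ∷ v ∈_) (sym (allVecs-product m n)) (∈-cartesianProductWith⁺ _∷_ (∈-allFin x) (∈-allVecs v))

  allVecs-unique : ∀ m n → Unique (allVecs m n)
  allVecs-unique zero    n = [] ∷ []
  allVecs-unique (suc m) n = subst Unique (sym (allVecs-product m n))
    (Unique.cartesianProductWith⁺ _∷_ Vec.∷-injective (Unique.allFin⁺ n) (allVecs-unique m n))

  involutions-unique : ∀ n → Unique (involutions n)
  involutions-unique n = Unique.filter⁺ isInvolution? (allVecs-unique n n)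

  ∈-involutions⁺ : ∀ {n} {π : Vec (Fin n) n} → IsInvolution π → π ∈ involutions n
  ∈-involutions⁺ {π = π} = ∈-filter⁺ isInvolution? (∈-allVecs π)

  ∈-involutions⁻ : ∀ {n} {π : Vec (Fin n) n} → π ∈ involutions n → IsInvolution π
  ∈-involutions⁻ {n} π∈ = proj₂ (∈-filter⁻ isInvolution? {xs = allVecs n n} π∈)

  -- Splitting the involutions by the image of the first point.

  fixFirst : ∀ {n} → Vec (Fin n) n → Vec (Fin (suc n)) (suc n)
  fixFirst v = zero ∷ Vec.map suc v

  -- The map `suc ∘ punchIn i` relabels `n` points as those other than `zero` and `suc i`; the
  -- `zero` inserted at `i` closes the new 2-cycle.
  swapFirst : ∀ {n} → Fin (suc n) → Vec (Fin n) n → Vec (Fin (2 + n)) (2 + n)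
  swapFirst i v = suc i ∷ insertAt (Vec.map (suc ∘ punchIn i) v) i zero

  module _ {n} (i : Fin (suc n)) (v : Vec (Fin n) n) where

    lookup-swapFirst-partner : lookup (swapFirst i v) (suc i) ≡ zero
    lookup-swapFirst-partner = Vec.insertAt-lookup (Vec.map (suc ∘ punchIn i) v) i zero

    lookup-swapFirst-punchIn : ∀ j → lookup (swapFirst i v) (suc (punchIn i j)) ≡ suc (punchIn i (lookup v j))
    lookup-swapFirst-punchIn j =
      trans (Vec.insertAt-punchIn (Vec.map (suc ∘ punchIn i) v) i zero j) (Vec.lookup-map j _ v)

  vec-ext : ∀ {A : Set} {n} {u v : Vec A n} → (∀ i → lookup u i ≡ lookup v i) → u ≡ v
  vec-ext {u = u} {v} eq =
    trans (sym (Vec.tabulate∘lookup u)) (trans (Vec.tabulate-cong eq) (Vec.tabulate∘lookup v))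

  data PunchInView {n} (i : Fin (suc n)) : Fin (suc n) → Set where
    hole  : PunchInView i i
    image : ∀ j → PunchInView i (punchIn i j)

  punchInView : ∀ {n} (i j : Fin (suc n)) → PunchInView i j
  punchInView i j with i ≟ᶠ j
  ... | yes refl = hole
  ... | no i≢j   = subst (PunchInView i) (punchIn-punchOut i≢j) (image (punchOut i≢j))

  fixFirst-involution : ∀ {n} {v : Vec (Fin n) n} → IsInvolution v → IsInvolution (fixFirst v)
  fixFirst-involution         inv zero    = refl
  fixFirst-involution {v = v} inv (suc i) =
    trans (cong (lookup (fixFirst v)) (Vec.lookup-map i suc v))
          (trans (Vec.lookup-map (lookup v i) suc v) (cong suc (inv i)))

  swapFirst-involution : ∀ {n} i {v : Vec (Fin n) n} → IsInvolution v → IsInvolution (swapFirst i v)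
  swapFirst-involution i {v} inv zero    = lookup-swapFirst-partner i v
  swapFirst-involution i {v} inv (suc j) with punchInView i j
  ... | hole    = cong (lookup (swapFirst i v)) (lookup-swapFirst-partner i v)
  ... | image k = trans (cong (lookup (swapFirst i v)) (lookup-swapFirst-punchIn i v k))
                        (trans (lookup-swapFirst-punchIn i v (lookup v k)) (cong (suc ∘ punchIn i) (inv k)))

  involution-injective : ∀ {n} {π : Vec (Fin n) n} → IsInvolution π →
                         ∀ {i j} → lookup π i ≡ lookup π j → i ≡ j
  involution-injective {π = π} inv {i} {j} eq = trans (sym (inv i)) (trans (cong (lookup π) eq) (inv j))

  fixFirst-surjective : ∀ {n} (π : Vec (Fin (suc n)) (suc n)) → IsInvolution π → lookup π zero ≡ zero →
                        ∃ λ v → IsInvolution v × π ≡ fixFirst v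
  fixFirst-surjective {n} π inv π0≡0 = v , v-inv , vec-ext π≗
    where
    restrict : ∀ i → ∃ λ j → lookup π (suc i) ≡ suc j
    restrict i with lookup π (suc i) in eq
    ... | suc j = j , refl
    ... | zero  = contradiction (involution-injective {π = π} inv (trans π0≡0 (sym eq))) λ ()

    v = Vec.tabulate (proj₁ ∘ restrict)

    π-suc : ∀ i → lookup π (suc i) ≡ suc (lookup v i)
    π-suc i = trans (proj₂ (restrict i)) (cong suc (sym (Vec.lookup∘tabulate (proj₁ ∘ restrict) i)))

    v-inv : IsInvolution v
    v-inv i = suc-injective (trans (sym (π-suc (lookup v i))) (trans (cong (lookup π) (sym (π-suc i))) (inv (suc i))))

    π≗ : ∀ i → lookup π i ≡ lookup (fixFirst v) i
    π≗ zero    = π0≡0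
    π≗ (suc i) = trans (π-suc i) (sym (Vec.lookup-map i suc v))

  swapFirst-surjective : ∀ {n} (π : Vec (Fin (2 + n)) (2 + n)) i → IsInvolution π → lookup π zero ≡ suc i →
                         ∃ λ v → IsInvolution v × π ≡ swapFirst i v
  swapFirst-surjective {n} π i inv π0≡i = v , v-inv , vec-ext π≗
    where
    π-partner : lookup π (suc i) ≡ zero
    π-partner = trans (cong (lookup π) (sym π0≡i)) (inv zero)

    -- The values `zero` and `suc i` are already taken, at `suc i` and `zero`, so injectivity leaves
    -- only values of the form `suc (punchIn i k)`.
    restrict : ∀ j → ∃ λ k → lookup π (suc (punchIn i j)) ≡ suc (punchIn i k)
    restrict j with lookup π (suc (punchIn i j)) in eq
    ... | zero  = contradiction
      (suc-injective (involution-injective {π = π} inv (trans eq (sym π-partner)))) (punchInᵢ≢i i j)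
    ... | suc l with punchInView i l
    ...   | hole    = contradiction (involution-injective {π = π} inv (trans π0≡i (sym eq))) λ ()
    ...   | image k = k , refl

    v = Vec.tabulate (proj₁ ∘ restrict)

    π-punchIn : ∀ j → lookup π (suc (punchIn i j)) ≡ suc (punchIn i (lookup v j))
    π-punchIn j = trans (proj₂ (restrict j))
      (cong (suc ∘ punchIn i) (sym (Vec.lookup∘tabulate (proj₁ ∘ restrict) j)))

    v-inv : IsInvolution v
    v-inv j = punchIn-injective i _ _ (suc-injective
      (trans (sym (π-punchIn (lookup v j))) (trans (cong (lookup π) (sym (π-punchIn j))) (inv (suc (punchIn i j))))))

    π≗ : ∀ j → lookup π j ≡ lookup (swapFirst i v) j
    π≗ zero    = π0≡i
    π≗ (suc j) with punchInView i j
    ... | hole    = trans π-partner (sym (lookup-swapFirst-partner i v))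
    ... | image k = trans (π-punchIn k) (sym (lookup-swapFirst-punchIn i v k))

  fixFirst-injective : ∀ {n} {u v : Vec (Fin n) n} → fixFirst u ≡ fixFirst v → u ≡ v
  fixFirst-injective {u = u} {v} eq = vec-ext λ i → suc-injective
    (trans (sym (Vec.lookup-map i suc u)) (trans (cong (λ w → lookup w (suc i)) eq) (Vec.lookup-map i suc v)))

  swapFirst-injective : ∀ {n} {i j} {u v : Vec (Fin n) n} → swapFirst i u ≡ swapFirst j v → i ≡ j × u ≡ v
  swapFirst-injective {i = i} {j} {u} {v} eq with suc-injective (cong (λ w → lookup w zero) eq)
  ... | refl = refl , vec-ext λ k → punchIn-injective i _ _ (suc-injective
    (trans (sym (lookup-swapFirst-punchIn i u k))
           (trans (cong (λ w → lookup w (suc (punchIn i k))) eq) (lookup-swapFirst-punchIn i v k))))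

  -- Both lists are free of repetitions, so having the same members already makes them equal as
  -- bags, hence permutations of each other. The two kinds of involution are disjoint because their
  -- first entries differ.
  involutions-split : ∀ n → involutions (2 + n) ↭
    map fixFirst (involutions (1 + n)) ++ cartesianProductWith swapFirst (allFin (1 + n)) (involutions n)
  involutions-split n = ∼bag⇒↭ (unique∧set⇒bag (involutions-unique (2 + n)) split-unique (mk⇔ to from))
    where
    fixing   = map fixFirst (involutions (1 + n))
    swapping = cartesianProductWith swapFirst (allFin (1 + n)) (involutions n)

    disjoint : ∀ {π} → ¬ (π ∈ fixing × π ∈ swapping)
    disjoint (π∈f , π∈s)
      with _ , _ , refl ← ∈-map⁻ fixFirst π∈f
      with ∈-cartesianProductWith⁻ swapFirst (allFin (1 + n)) (involutions n) π∈s
    ... | _ , _ , _ , _ , ()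

    split-unique : Unique (fixing ++ swapping)
    split-unique = Unique.++⁺
      (Unique.map⁺ fixFirst-injective (involutions-unique (1 + n)))
      (Unique.cartesianProductWith⁺ swapFirst swapFirst-injective (Unique.allFin⁺ (1 + n)) (involutions-unique n))
      disjoint

    to : ∀ {π} → π ∈ involutions (2 + n) → π ∈ fixing ++ swapping
    to {π} π∈ with ∈-involutions⁻ π∈ | lookup π zero in eq
    ... | inv | zero  with v , v-inv , refl ← fixFirst-surjective π inv eq =
      ∈-++⁺ˡ (∈-map⁺ fixFirst (∈-involutions⁺ v-inv))
    ... | inv | suc i with v , v-inv , refl ← swapFirst-surjective π i inv eq =
      ∈-++⁺ʳ fixing (∈-cartesianProductWith⁺ swapFirst (∈-allFin i) (∈-involutions⁺ v-inv))

    from : ∀ {π} → π ∈ fixing ++ swapping → π ∈ involutions (2 + n)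
    from π∈ with ∈-++⁻ fixing π∈
    ... | inj₁ π∈f with _ , v∈ , refl ← ∈-map⁻ fixFirst π∈f =
      ∈-involutions⁺ (fixFirst-involution (∈-involutions⁻ v∈))
    ... | inj₂ π∈s with i , _ , _ , v∈ , refl ← ∈-cartesianProductWith⁻ swapFirst (allFin (1 + n)) (involutions n) π∈s =
      ∈-involutions⁺ (swapFirst-involution i (∈-involutions⁻ v∈))

  -- Two-cycle counts and the recurrence for weighted sums over involutions.

  less : ℕ → ℕ → ℕ
  less m n = if m <ᵇ n then 1 else 0

  length-filter-tabulate : ∀ {a p} {A : Set a} {P : Pred A p} (P? : Decidable P) {n} (f : Fin n → A) →
    length (filter P? (tabulate f)) ≡ ∑[ i < n ] (if does (P? (f i)) then 1 else 0)
  length-filter-tabulate P? {zero}  f = refl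
  length-filter-tabulate P? {suc n} f with does (P? (f zero))
  ... | true  = cong suc (length-filter-tabulate P? (f ∘ suc))
  ... | false = length-filter-tabulate P? (f ∘ suc)

  twoCycles-sum : ∀ {n} (π : Vec (Fin n) n) → twoCycles π ≡ ∑[ i < n ] less (toℕ i) (toℕ (lookup π i))
  twoCycles-sum π = length-filter-tabulate (λ i → toℕ i <? toℕ (lookup π i)) id

  -- Since `punchIn i` is strictly increasing, relabelling does not change which end of a 2-cycle is
  -- the smaller one.
  less-punchIn : ∀ {n} (i : Fin (suc n)) j k →
    less (toℕ (punchIn i j)) (toℕ (punchIn i k)) ≡ less (toℕ j) (toℕ k)
  less-punchIn zero    j       k       = refl
  less-punchIn (suc i) zero    zero    = refl
  less-punchIn (suc i) zero    (suc k) = refl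
  less-punchIn (suc i) (suc j) zero    = refl
  less-punchIn (suc i) (suc j) (suc k) = less-punchIn i j k

  twoCycles-fixFirst : ∀ {n} (v : Vec (Fin n) n) → twoCycles (fixFirst v) ≡ twoCycles v
  twoCycles-fixFirst v = trans (twoCycles-sum (fixFirst v)) (trans
    (sum-cong-≗ (λ i → cong (λ j → less (suc (toℕ i)) (toℕ j)) (Vec.lookup-map i suc v)))
    (sym (twoCycles-sum v)))

  -- The new 2-cycle is counted at `zero` and not at `suc i`, whose image is smaller; the remaining
  -- summands are those of `v`.
  twoCycles-swapFirst : ∀ {n} i (v : Vec (Fin n) n) → twoCycles (swapFirst i v) ≡ suc (twoCycles v)
  twoCycles-swapFirst {n} i v = trans (twoCycles-sum π) (cong suc (begin
      ∑[ j < suc n ] g j                    ≡⟨ sum-remove {i = i} g ⟩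
      g i + ∑[ j < n ] g (punchIn i j)      ≡⟨ cong₂ _+_
        (cong (λ j → less (suc (toℕ i)) (toℕ j)) (lookup-swapFirst-partner i v))
        (sum-cong-≗ λ j → trans (cong (λ k → less (suc (toℕ (punchIn i j))) (toℕ k)) (lookup-swapFirst-punchIn i v j))
                                (less-punchIn i j (lookup v j))) ⟩
      ∑[ j < n ] less (toℕ j) (toℕ (lookup v j)) ≡⟨ twoCycles-sum v ⟨
      twoCycles v ∎))
    where
    open ≡-Reasoning
    π = swapFirst i v
    g : Fin (suc n) → ℕ
    g j = less (suc (toℕ j)) (toℕ (lookup π (suc j)))

  -- The weight is arbitrary, not just the parity, because removing a 2-cycle replaces `w` by
  -- `w ∘ suc` in the recurrence.
  weight : ℕ → (ℕ → ℕ) → ℕ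
  weight n w = sum (map (w ∘ twoCycles) (involutions n))

  sum-cartesianProductWith : ∀ {A B C : Set} (f : A → B → C) (g : C → ℕ) (h : B → ℕ) →
    (∀ x y → g (f x y) ≡ h y) → ∀ xs ys →
    sum (map g (cartesianProductWith f xs ys)) ≡ length xs * sum (map h ys)
  sum-cartesianProductWith f g h gf≡h []       ys = refl
  sum-cartesianProductWith f g h gf≡h (x ∷ xs) ys = begin
    sum (map g (map (f x) ys ++ rest))               ≡⟨ cong sum (List.map-++ g (map (f x) ys) rest) ⟩
    sum (map g (map (f x) ys) ++ map g rest)         ≡⟨ sum-++ (map g (map (f x) ys)) (map g rest) ⟩
    sum (map g (map (f x) ys)) + sum (map g rest)    ≡⟨ cong₂ _+_
      (cong sum (trans (sym (List.map-∘ ys)) (List.map-cong (gf≡h x) ys)))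
      (sum-cartesianProductWith f g h gf≡h xs ys) ⟩
    sum (map h ys) + length xs * sum (map h ys)      ∎
    where
    open ≡-Reasoning
    rest = cartesianProductWith f xs ys

  weight-recurrence : ∀ n w → weight (2 + n) w ≡ weight (1 + n) w + (1 + n) * weight n (w ∘ suc)
  weight-recurrence n w = begin
    sum (map g (involutions (2 + n)))            ≡⟨ sum-↭ (map⁺ g (involutions-split n)) ⟩
    sum (map g (fixing ++ swapping))             ≡⟨ cong sum (List.map-++ g fixing swapping) ⟩
    sum (map g fixing ++ map g swapping)         ≡⟨ sum-++ (map g fixing) (map g swapping) ⟩
    sum (map g fixing) + sum (map g swapping)    ≡⟨ cong₂ _+_
      (cong sum (trans (sym (List.map-∘ (involutions (1 + n))))
                       (List.map-cong (cong w ∘ twoCycles-fixFirst) (involutions (1 + n)))))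
      (sum-cartesianProductWith swapFirst g _ (λ i v → cong w (twoCycles-swapFirst i v)) (allFin (1 + n)) (involutions n)) ⟩
    weight (1 + n) w + length (allFin (1 + n)) * weight n (w ∘ suc)
                                                 ≡⟨ cong (λ l → weight (1 + n) w + l * weight n (w ∘ suc)) (List.length-tabulate {n = 1 + n} id) ⟩
    weight (1 + n) w + (1 + n) * weight n (w ∘ suc) ∎
    where
    open ≡-Reasoning
    g : ∀ {n} → Vec (Fin n) n → ℕ
    g = w ∘ twoCycles
    fixing   = map fixFirst (involutions (1 + n))
    swapping = cartesianProductWith swapFirst (allFin (1 + n)) (involutions n)

  length-filter-odd : ∀ {A : Set} (f : A → ℕ) xs → length (filter (λ x → f x % 2 ≟ 1) xs) ≡ sum (map (λ x → f x % 2) xs)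
  length-filter-odd f []       = refl
  length-filter-odd f (x ∷ xs) with f x % 2 | m%2 (f x)
    where
    m%2 : ∀ m → m % 2 ≡ 0 ⊎ m % 2 ≡ 1
    m%2 zero          = inj₁ refl
    m%2 (suc zero)    = inj₂ refl
    m%2 (suc (suc m)) = m%2 m
  ... | _ | inj₁ refl = length-filter-odd f xs
  ... | _ | inj₂ refl = cong suc (length-filter-odd f xs)

  tᵒ-weight : ∀ n → tᵒ n ≡ weight n (_% 2)
  tᵒ-weight n = length-filter-odd twoCycles (involutions n)

  -- Numbers of involutions with a given number of 2-cycles.

  ∑< : ℕ → (ℕ → ℕ) → ℕ
  ∑< zero    f = 0
  ∑< (suc n) f = f 0 + ∑< n (f ∘ suc)

  ∑<-cong : ∀ n {f g : ℕ → ℕ} → (∀ j → f j ≡ g j) → ∑< n f ≡ ∑< n g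
  ∑<-cong zero    eq = refl
  ∑<-cong (suc n) eq = cong₂ _+_ (eq 0) (∑<-cong n (eq ∘ suc))

  ∑<-zero : ∀ n → ∑< n (λ _ → 0) ≡ 0
  ∑<-zero zero    = refl
  ∑<-zero (suc n) = ∑<-zero n

  interchange : ∀ a b c x y → a + c * b + (x + c * y) ≡ (a + x) + c * (b + y)
  interchange = solve-∀

  ∑<-linear : ∀ n (f g : ℕ → ℕ) c → ∑< n (λ j → f j + c * g j) ≡ ∑< n f + c * ∑< n g
  ∑<-linear zero    f g c = sym (ℕ.*-zeroʳ c)
  ∑<-linear (suc n) f g c =
    trans (cong (f 0 + c * g 0 +_) (∑<-linear n (f ∘ suc) (g ∘ suc) c)) (interchange (f 0) (g 0) c _ _)

  ∑<-odd : ∀ n (f : ℕ → ℕ) → ∑< (1 + 2 * n) (λ j → f j * (j % 2)) ≡ ∑< n (λ j → f (1 + 2 * j))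
  ∑<-odd n f = cong₂ _+_ (ℕ.*-zeroʳ (f 0)) (odds n (λ j → f (suc j)))
    where
    odds : ∀ n (g : ℕ → ℕ) → ∑< (2 * n) (λ j → g j * (suc j % 2)) ≡ ∑< n (λ j → g (2 * j))
    odds zero    g = refl
    odds (suc n) g = begin
      ∑< (2 * suc n) (λ j → g j * (suc j % 2))
        ≡⟨ cong (λ l → ∑< l (λ j → g j * (suc j % 2))) (ℕ.*-suc 2 n) ⟩
      g 0 * 1 + (g 1 * 0 + ∑< (2 * n) (λ j → g (2 + j) * (suc j % 2)))
        ≡⟨ cong₂ (λ x y → x + (y + ∑< (2 * n) (λ j → g (2 + j) * (suc j % 2)))) (ℕ.*-identityʳ (g 0)) (ℕ.*-zeroʳ (g 1)) ⟩
      g 0 + ∑< (2 * n) (λ j → g (2 + j) * (suc j % 2))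
        ≡⟨ cong (g 0 +_) (trans (odds n (λ j → g (2 + j))) (∑<-cong n λ j → cong g (sym (ℕ.*-suc 2 j)))) ⟩
      g 0 + ∑< n (λ j → g (2 * suc j)) ∎
      where open ≡-Reasoning

  involutionsWith : ℕ → ℕ → ℕ
  involutionsWith n             zero    = 1
  involutionsWith zero          (suc j) = 0
  involutionsWith (suc zero)    (suc j) = 0
  involutionsWith (suc (suc n)) (suc j) = involutionsWith (suc n) (suc j) + (1 + n) * involutionsWith n j

  -- At most n / 2 two-cycles fit, so every `J` with `n < 2 * J` is long enough. Leaving `J` free
  -- lets it drop together with the shift of `w`.
  weight-expansion : ∀ n J w → n < 2 * J → weight n w ≡ ∑< J (λ j → involutionsWith n j * w j)
  weight-expansion zero          (suc J) w _ = sym (cong₂ _+_ (ℕ.+-identityʳ (w 0)) (∑<-zero J))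
  weight-expansion (suc zero)    (suc J) w _ = sym (cong₂ _+_ (ℕ.+-identityʳ (w 0)) (∑<-zero J))
  weight-expansion (suc (suc n)) (suc J) w n+2<2J+2 = begin
    weight (2 + n) w
      ≡⟨ weight-recurrence n w ⟩
    weight (1 + n) w + (1 + n) * weight n (w ∘ suc)
      ≡⟨ cong₂ (λ x y → x + (1 + n) * y) (weight-expansion (suc n) (suc J) w (ℕ.<-trans (ℕ.n<1+n _) n+2<2J+2))
                                         (weight-expansion n J (w ∘ suc) n<2J) ⟩
    1 * w 0 + ∑< J (λ j → N (1 + n) (suc j) * w (suc j)) + (1 + n) * ∑< J (λ j → N n j * w (suc j))
      ≡⟨ ℕ.+-assoc (1 * w 0) _ _ ⟩
    1 * w 0 + (∑< J (λ j → N (1 + n) (suc j) * w (suc j)) + (1 + n) * ∑< J (λ j → N n j * w (suc j)))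
      ≡⟨ cong (1 * w 0 +_) (sym (∑<-linear J (λ j → N (1 + n) (suc j) * w (suc j)) (λ j → N n j * w (suc j)) (1 + n))) ⟩
    1 * w 0 + ∑< J (λ j → N (1 + n) (suc j) * w (suc j) + (1 + n) * (N n j * w (suc j)))
      ≡⟨ cong (1 * w 0 +_) (∑<-cong J λ j → collect (N (1 + n) (suc j)) (w (suc j)) (1 + n) (N n j)) ⟩
    1 * w 0 + ∑< J (λ j → (N (1 + n) (suc j) + (1 + n) * N n j) * w (suc j))
      ∎
    where
    open ≡-Reasoning
    N = involutionsWith
    collect : ∀ a x c b → a * x + c * (b * x) ≡ (a + c * b) * x
    collect = solve-∀
    n<2J : n < 2 * J
    n<2J = s<s⁻¹ (s<s⁻¹ (subst (2 + n <_) (ℕ.*-suc 2 J) n+2<2J+2))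

  involutionsWith-vanish : ∀ n j → n < 2 * j → involutionsWith n j ≡ 0
  involutionsWith-vanish zero          (suc j) _ = refl
  involutionsWith-vanish (suc zero)    (suc j) _ = refl
  involutionsWith-vanish (suc (suc n)) (suc j) n+2<2j+2
    rewrite involutionsWith-vanish (suc n) (suc j) (ℕ.<-trans (ℕ.n<1+n _) n+2<2j+2)
          | involutionsWith-vanish n j (s<s⁻¹ (s<s⁻¹ (subst (2 + n <_) (ℕ.*-suc 2 j) n+2<2j+2)))
    = ℕ.*-zeroʳ n

  -- The count n! / (2ʲ j! f!) with `f` fixed points, cleared of denominators; taking `f` in place
  -- of `n` as the parameter avoids subtraction.
  involutionsWith-closed : ∀ f j → involutionsWith (f + 2 * j) j * (2 ^ j * j ! * f !) ≡ (f + 2 * j) !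
  involutionsWith-closed f zero rewrite ℕ.+-identityʳ f = unit (f !)
    where
    unit : ∀ x → 1 * (1 * 1 * x) ≡ x
    unit = solve-∀
  -- Without fixed points the first summand of the recurrence vanishes: 2j + 1 points cannot carry j
  -- + 1 two-cycles.
  involutionsWith-closed zero (suc j) = subst (λ n → N n (suc j) * (2 ^ suc j * suc j ! * 1) ≡ n !) (sym (ℕ.*-suc 2 j)) (begin
    (N (1 + 2 * j) (suc j) + (1 + 2 * j) * N (2 * j) j) * (2 ^ suc j * suc j ! * 1)
      ≡⟨ cong (λ x → (x + (1 + 2 * j) * N (2 * j) j) * (2 ^ suc j * suc j ! * 1))
              (involutionsWith-vanish (1 + 2 * j) (suc j) (subst (1 + 2 * j <_) (sym (ℕ.*-suc 2 j)) (ℕ.n<1+n _))) ⟩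
    (1 + 2 * j) * N (2 * j) j * (2 ^ suc j * suc j ! * 1)
      ≡⟨ regroup (N (2 * j) j) (2 ^ j) j (j !) ⟩
    (2 + 2 * j) * ((1 + 2 * j) * (N (2 * j) j * (2 ^ j * j ! * 1)))
      ≡⟨ cong (λ x → (2 + 2 * j) * ((1 + 2 * j) * x)) (involutionsWith-closed 0 j) ⟩
    (2 + 2 * j) ! ∎)
    where
    open ≡-Reasoning
    N = involutionsWith
    regroup : ∀ x p j q → (1 + 2 * j) * x * (2 * p * ((1 + j) * q) * 1) ≡ (2 + 2 * j) * ((1 + 2 * j) * (x * (p * q * 1)))
    regroup = solve-∀
  involutionsWith-closed (suc f) (suc j) = subst (λ n → N n (suc j) * (2 ^ suc j * suc j ! * suc f !) ≡ n !) (shift f j) (begin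
    (N (2 + f + 2 * j) (suc j) + (2 + f + 2 * j) * N (1 + f + 2 * j) j) * (2 ^ suc j * suc j ! * suc f !)
      ≡⟨ regroup (N (2 + f + 2 * j) (suc j)) (N (1 + f + 2 * j) j) (2 ^ j) j (j !) f (f !) ⟩
    (1 + f) * (N (2 + f + 2 * j) (suc j) * (2 ^ suc j * suc j ! * f !))
      + (2 + f + 2 * j) * (2 * (1 + j)) * (N (1 + f + 2 * j) j * (2 ^ j * j ! * suc f !))
      ≡⟨ cong₂ (λ x y → (1 + f) * x + (2 + f + 2 * j) * (2 * (1 + j)) * y)
           (subst (λ n → N n (suc j) * (2 ^ suc j * suc j ! * f !) ≡ n !) (sym (ℕ.suc-injective (shift f j)))
                  (involutionsWith-closed f (suc j)))
           (involutionsWith-closed (suc f) j) ⟩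
    (1 + f) * ((2 + f + 2 * j) * (1 + f + 2 * j) !) + (2 + f + 2 * j) * (2 * (1 + j)) * (1 + f + 2 * j) !
      ≡⟨ combine f j ((1 + f + 2 * j) !) ⟩
    (3 + f + 2 * j) * ((2 + f + 2 * j) * (1 + f + 2 * j) !)
      ∎)
    where
    open ≡-Reasoning
    N = involutionsWith
    shift : ∀ f j → 3 + f + 2 * j ≡ 1 + f + 2 * (1 + j)
    shift = solve-∀
    regroup : ∀ x y p j q f r → (x + (2 + f + 2 * j) * y) * (2 * p * ((1 + j) * q) * ((1 + f) * r)) ≡
      (1 + f) * (x * (2 * p * ((1 + j) * q) * r)) + (2 + f + 2 * j) * (2 * (1 + j)) * (y * (p * q * ((1 + f) * r)))
    regroup = solve-∀
    combine : ∀ f j r → (1 + f) * ((2 + f + 2 * j) * r) + (2 + f + 2 * j) * (2 * (1 + j)) * r ≡ (3 + f + 2 * j) * ((2 + f + 2 * j) * r)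
    combine = solve-∀

  -- Sums over i + j = s and Pascal's rule.

  antiSum : ℕ → (ℕ → ℕ → ℕ) → ℕ
  antiSum zero    h = h 0 0
  antiSum (suc s) h = h (suc s) 0 + antiSum s (λ i j → h i (suc j))

  antiSum-cong : ∀ s {g h : ℕ → ℕ → ℕ} → (∀ i j → i + j ≡ s → g i j ≡ h i j) → antiSum s g ≡ antiSum s h
  antiSum-cong zero    eq = eq 0 0 refl
  antiSum-cong (suc s) eq = cong₂ _+_ (eq (suc s) 0 (ℕ.+-identityʳ _))
    (antiSum-cong s λ i j i+j≡s → eq i (suc j) (trans (ℕ.+-suc i j) (cong suc i+j≡s)))

  antiSum-*ʳ : ∀ s (h : ℕ → ℕ → ℕ) c → antiSum s h * c ≡ antiSum s (λ i j → h i j * c)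
  antiSum-*ʳ zero    h c = refl
  antiSum-*ʳ (suc s) h c = trans (ℕ.*-distribʳ-+ c (h (suc s) 0) _)
    (cong (h (suc s) 0 * c +_) (antiSum-*ʳ s (λ i j → h i (suc j)) c))

  antiSum-+ : ∀ s (g h : ℕ → ℕ → ℕ) → antiSum s (λ i j → g i j + h i j) ≡ antiSum s g + antiSum s h
  antiSum-+ zero    g h = refl
  antiSum-+ (suc s) g h =
    trans (cong (g (suc s) 0 + h (suc s) 0 +_) (antiSum-+ s (λ i j → g i (suc j)) (λ i j → h i (suc j))))
          (swap (g (suc s) 0) (h (suc s) 0) _ _)
    where
    swap : ∀ a b x y → a + b + (x + y) ≡ (a + x) + (b + y)
    swap = solve-∀

  ∑<-antiSum : ∀ s f → ∑< (suc s) f ≡ antiSum s (λ _ j → f j)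
  ∑<-antiSum zero    f = ℕ.+-identityʳ (f 0)
  ∑<-antiSum (suc s) f = cong (f 0 +_) (∑<-antiSum s (f ∘ suc))

  -- The two neighbours in Pascal's triangle, with 0 outside it, so that Pascal's rule takes one
  -- form on the edges and in the interior.
  leftOf belowOf : (ℕ → ℕ → ℕ) → ℕ → ℕ → ℕ
  leftOf h zero    j = 0
  leftOf h (suc i) j = h i j
  belowOf h i zero    = 0
  belowOf h i (suc j) = h i j

  antiSum-leftOf : ∀ s h → antiSum (suc s) (leftOf h) ≡ antiSum s h
  antiSum-leftOf zero    h = ℕ.+-identityʳ _
  antiSum-leftOf (suc s) h = cong (h (suc s) 0 +_)
    (trans (antiSum-cong (suc s) λ i j _ → leftOf-suc i j) (antiSum-leftOf s (λ i j → h i (suc j))))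
    where
    leftOf-suc : ∀ i j → leftOf h i (suc j) ≡ leftOf (λ i j → h i (suc j)) i j
    leftOf-suc zero    j = refl
    leftOf-suc (suc i) j = refl

  -- The binomial coefficient (i + j choose i); the symmetric indexing fits sums over i + j = s.
  choose : ℕ → ℕ → ℕ
  choose zero    j       = 1
  choose (suc i) zero    = 1
  choose (suc i) (suc j) = choose i (suc j) + choose (suc i) j

  choose-! : ∀ i j → choose i j * (i ! * j !) ≡ (i + j) !
  choose-! zero    j       = unit (j !)
    where
    unit : ∀ x → 1 * (1 * x) ≡ x
    unit = solve-∀
  choose-! (suc i) zero    rewrite ℕ.+-identityʳ i = unit (suc i !)
    where
    unit : ∀ x → 1 * (x * 1) ≡ x
    unit = solve-∀
  choose-! (suc i) (suc j) = begin
    (choose i (suc j) + choose (suc i) j) * (suc i ! * suc j !)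
      ≡⟨ regroup (choose i (suc j)) (choose (suc i) j) i j (i !) (j !) ⟩
    (1 + i) * (choose i (suc j) * (i ! * suc j !)) + (1 + j) * (choose (suc i) j * (suc i ! * j !))
      ≡⟨ cong₂ (λ x y → (1 + i) * x + (1 + j) * y) (choose-! i (suc j))
           (trans (choose-! (suc i) j) (cong _! (sym (ℕ.+-suc i j)))) ⟩
    (1 + i) * (i + suc j) ! + (1 + j) * (i + suc j) !
      ≡⟨ collect i j ((i + suc j) !) ⟩
    (1 + i + suc j) * (i + suc j) ! ∎
    where
    open ≡-Reasoning
    regroup : ∀ x y i j p q → (x + y) * ((1 + i) * p * ((1 + j) * q)) ≡ (1 + i) * (x * (p * ((1 + j) * q))) + (1 + j) * (y * ((1 + i) * p * q))
    regroup = solve-∀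
    collect : ∀ i j r → (1 + i) * r + (1 + j) * r ≡ (1 + i + (1 + j)) * r
    collect = solve-∀

  -- The sum over r + t = s of (s choose r) `h r t`, with Pascal's rule built into the recursion so
  -- that no binomial coefficient remains.
  binomialSum : ℕ → (ℕ → ℕ → ℕ) → ℕ
  binomialSum zero    h = h 0 0
  binomialSum (suc s) h = binomialSum s (λ i j → h (suc i) j) + binomialSum s (λ i j → h i (suc j))

  antiSum-choose : ∀ s h → antiSum s (λ i j → choose i j * h i j) ≡ binomialSum s h
  antiSum-choose zero    h = ℕ.+-identityʳ _
  antiSum-choose (suc s) h = begin
    antiSum (suc s) (λ i j → choose i j * h i j)
      ≡⟨ antiSum-cong (suc s) pascal ⟩
    antiSum (suc s) (λ i j → leftOf g₁ i j + belowOf g₂ i j)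
      ≡⟨ antiSum-+ (suc s) (leftOf g₁) (belowOf g₂) ⟩
    antiSum (suc s) (leftOf g₁) + antiSum s g₂
      ≡⟨ cong₂ _+_ (trans (antiSum-leftOf s g₁) (antiSum-choose s (λ i j → h (suc i) j))) (antiSum-choose s (λ i j → h i (suc j))) ⟩
    binomialSum (suc s) h ∎
    where
    open ≡-Reasoning
    g₁ g₂ : ℕ → ℕ → ℕ
    g₁ i j = choose i j * h (suc i) j
    g₂ i j = choose i j * h i (suc j)
    choose-zeroʳ : ∀ i → choose i 0 ≡ 1
    choose-zeroʳ zero    = refl
    choose-zeroʳ (suc i) = refl
    pascal : ∀ i j → i + j ≡ suc s → choose i j * h i j ≡ leftOf g₁ i j + belowOf g₂ i j
    pascal zero    (suc j) _ = refl
    pascal (suc i) zero    _ rewrite choose-zeroʳ i = sym (ℕ.+-identityʳ _)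
    pascal (suc i) (suc j) _ = ℕ.*-distribʳ-+ (h (suc i) (suc j)) (choose i (suc j)) (choose (suc i) j)

  -- Double factorials and the count for an odd number of 2-cycles.

  -- (2i + 1)!!
  oddFactorial : ℕ → ℕ
  oddFactorial zero    = 1
  oddFactorial (suc i) = (3 + 2 * i) * oddFactorial i

  -- The even factors 2 · 4 ⋯ 2i multiply to 2ⁱ i!.
  odd-! : ∀ i → (1 + 2 * i) ! ≡ 2 ^ i * i ! * oddFactorial i
  odd-! zero    = refl
  odd-! (suc i) = begin
    (1 + 2 * suc i) !                                      ≡⟨ cong (λ n → (1 + n) !) (ℕ.*-suc 2 i) ⟩
    (3 + 2 * i) * ((2 + 2 * i) * (1 + 2 * i) !)            ≡⟨ cong (λ x → (3 + 2 * i) * ((2 + 2 * i) * x)) (odd-! i) ⟩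
    (3 + 2 * i) * ((2 + 2 * i) * (2 ^ i * i ! * oddFactorial i)) ≡⟨ regroup i (2 ^ i) (i !) (oddFactorial i) ⟩
    2 ^ suc i * suc i ! * oddFactorial (suc i)             ∎
    where
    open ≡-Reasoning
    regroup : ∀ i p q r → (3 + 2 * i) * ((2 + 2 * i) * (p * q * r)) ≡ 2 * p * ((1 + i) * q) * ((3 + 2 * i) * r)
    regroup = solve-∀

  -- a and b are the ratios of consecutive values of A and B.
  a b A B : ℕ → ℕ
  a i = (3 + 2 * i) * (5 + 4 * i) * (7 + 4 * i)
  b j = 3 + 2 * j
  A i = oddFactorial i * oddFactorial (1 + 2 * i)
  B j = oddFactorial j

  A-suc : ∀ i → A (suc i) ≡ a i * A i
  A-suc i = trans (cong (λ n → (3 + 2 * i) * oddFactorial i * oddFactorial (1 + n)) (ℕ.*-suc 2 i))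
                  (regroup i (oddFactorial i) (oddFactorial (1 + 2 * i)))
    where
    regroup : ∀ i p q → (3 + 2 * i) * p * ((3 + 2 * (2 + 2 * i)) * ((3 + 2 * (1 + 2 * i)) * q)) ≡
              (3 + 2 * i) * (5 + 4 * i) * (7 + 4 * i) * (p * q)
    regroup = solve-∀

  -- There are 4i + 3 fixed points. Splitting all factorials by `odd-!`, applied twice to (4i + 3)!,
  -- produces the power 2 ^ (3m + 2) on both sides, independently of `i`; it cancels, and i! and j!
  -- combine with m! into `choose i j`.
  involutionsWith-odd : ∀ m i j → i + j ≡ m →
    involutionsWith (1 + 2 * (2 + 2 * m)) (1 + 2 * j) * (A i * B j) ≡
    (2 + 2 * m) * (oddFactorial m * oddFactorial (2 + 2 * m)) * choose i j
  involutionsWith-odd m i j refl = ℕ.*-cancelʳ-≡ _ _ (pow * (i ! * j !)) {{nonZero}} (begin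
    N * (A i * B j) * (pow * (i ! * j !))
      ≡⟨ cong (λ p → N * (A i * B j) * (p * (i ! * j !))) (sym pow-split) ⟩
    N * (A i * B j) * ((2 ^ (1 + 2 * j) * 2 ^ j) * (2 ^ (1 + 2 * i) * 2 ^ i) * (i ! * j !))
      ≡⟨ regroupˡ N (oddFactorial i) (oddFactorial (1 + 2 * i)) (oddFactorial j) (2 ^ (1 + 2 * j)) (2 ^ j) (2 ^ (1 + 2 * i)) (2 ^ i) (i !) (j !) ⟩
    N * (2 ^ (1 + 2 * j) * (2 ^ j * j ! * oddFactorial j) *
         (2 ^ (1 + 2 * i) * (2 ^ i * i ! * oddFactorial i) * oddFactorial (1 + 2 * i)))
      ≡⟨ cong₂ (λ x y → N * (2 ^ (1 + 2 * j) * x * (2 ^ (1 + 2 * i) * y * oddFactorial (1 + 2 * i)))) (odd-! j) (odd-! i) ⟨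
    N * (2 ^ (1 + 2 * j) * (1 + 2 * j) ! * (2 ^ (1 + 2 * i) * (1 + 2 * i) ! * oddFactorial (1 + 2 * i)))
      ≡⟨ cong (λ x → N * (2 ^ (1 + 2 * j) * (1 + 2 * j) ! * x)) (odd-! (1 + 2 * i)) ⟨
    N * (2 ^ (1 + 2 * j) * (1 + 2 * j) ! * (1 + 2 * (1 + 2 * i)) !)
      ≡⟨ cong (λ n → involutionsWith n (1 + 2 * j) * (2 ^ (1 + 2 * j) * (1 + 2 * j) ! * (1 + 2 * (1 + 2 * i)) !)) (size i j) ⟩
    involutionsWith (1 + 2 * (1 + 2 * i) + 2 * (1 + 2 * j)) (1 + 2 * j) * (2 ^ (1 + 2 * j) * (1 + 2 * j) ! * (1 + 2 * (1 + 2 * i)) !)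
      ≡⟨ involutionsWith-closed (1 + 2 * (1 + 2 * i)) (1 + 2 * j) ⟩
    (1 + 2 * (1 + 2 * i) + 2 * (1 + 2 * j)) !
      ≡⟨ cong _! (size i j) ⟨
    (1 + 2 * (2 + 2 * m)) !
      ≡⟨ odd-! (2 + 2 * m) ⟩
    2 ^ (2 + 2 * m) * ((2 + 2 * m) * (1 + 2 * m) !) * oddFactorial (2 + 2 * m)
      ≡⟨ cong (λ x → 2 ^ (2 + 2 * m) * ((2 + 2 * m) * x) * oddFactorial (2 + 2 * m)) (odd-! m) ⟩
    2 ^ (2 + 2 * m) * ((2 + 2 * m) * (2 ^ m * m ! * oddFactorial m)) * oddFactorial (2 + 2 * m)
      ≡⟨ cong (λ x → 2 ^ (2 + 2 * m) * ((2 + 2 * m) * (2 ^ m * x * oddFactorial m)) * oddFactorial (2 + 2 * m)) (choose-! i j) ⟨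
    2 ^ (2 + 2 * m) * ((2 + 2 * m) * (2 ^ m * (choose i j * (i ! * j !)) * oddFactorial m)) * oddFactorial (2 + 2 * m)
      ≡⟨ regroupʳ (2 ^ (2 + 2 * m)) (2 + 2 * m) (2 ^ m) (choose i j) (i ! * j !) (oddFactorial m) (oddFactorial (2 + 2 * m)) ⟩
    (2 + 2 * m) * (oddFactorial m * oddFactorial (2 + 2 * m)) * choose i j * (pow * (i ! * j !)) ∎)
    where
    open ≡-Reasoning
    N   = involutionsWith (1 + 2 * (2 + 2 * m)) (1 + 2 * j)
    pow = 2 ^ (2 + 2 * m) * 2 ^ m
    nonZero : NonZero (pow * (i ! * j !))
    nonZero = ℕ.m*n≢0 pow (i ! * j !) {{ℕ.m*n≢0 (2 ^ (2 + 2 * m)) (2 ^ m) {{ℕ.m^n≢0 2 (2 + 2 * m)}} {{ℕ.m^n≢0 2 m}}}} {{i ℕ.!* j !≢0}}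
    size : ∀ i j → 1 + 2 * (2 + 2 * (i + j)) ≡ 1 + 2 * (1 + 2 * i) + 2 * (1 + 2 * j)
    size = solve-∀
    exponent : ∀ i j → 1 + 2 * j + j + (1 + 2 * i + i) ≡ 2 + 2 * (i + j) + (i + j)
    exponent = solve-∀
    pow-split : (2 ^ (1 + 2 * j) * 2 ^ j) * (2 ^ (1 + 2 * i) * 2 ^ i) ≡ pow
    pow-split = begin
      (2 ^ (1 + 2 * j) * 2 ^ j) * (2 ^ (1 + 2 * i) * 2 ^ i)
        ≡⟨ cong₂ _*_ (ℕ.^-distribˡ-+-* 2 (1 + 2 * j) j) (ℕ.^-distribˡ-+-* 2 (1 + 2 * i) i) ⟨
      2 ^ (1 + 2 * j + j) * 2 ^ (1 + 2 * i + i)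
        ≡⟨ ℕ.^-distribˡ-+-* 2 (1 + 2 * j + j) (1 + 2 * i + i) ⟨
      2 ^ (1 + 2 * j + j + (1 + 2 * i + i))
        ≡⟨ cong (2 ^_) (exponent i j) ⟩
      2 ^ (2 + 2 * m + m)
        ≡⟨ ℕ.^-distribˡ-+-* 2 (2 + 2 * m) m ⟩
      pow ∎
    regroupˡ : ∀ n oi oi' oj p q r s f g →
      n * (oi * oi' * oj) * ((p * q) * (r * s) * (f * g)) ≡ n * (p * (q * g * oj) * (r * (s * f * oi) * oi'))
    regroupˡ = solve-∀
    regroupʳ : ∀ p k q c f o o' → p * (k * (q * (c * f) * o)) * o' ≡ k * (o * o') * c * (p * q * f)
    regroupʳ = solve-∀

  -- The sum `Q` and the formula for `tᵒ`.

  -- The sum over r + t = s of (s choose r) A(i + s) B(j + s) / (A(i + r) B(j + t)).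
  Q : ℕ → ℕ → ℕ → ℕ
  Q zero    i j = 1
  Q (suc s) i j = b (j + s) * Q s (suc i) j + a (i + s) * Q s i (suc j)

  -- Here `h r t` plays the part of K / (A (i + r) B (j + t)). Of the two halves given by Pascal's
  -- rule, one has its denominators cleared by A (i + 1 + s) B (j + s), the other by A (i + s) B (j
  -- + 1 + s); against the common multiplier this leaves the factors `b (j + s)` and `a (i + s)`.
  binomialSum-Q : ∀ s i j h K → (∀ r t → r + t ≡ s → h r t * (A (i + r) * B (j + t)) ≡ K) →
    binomialSum s h * (A (i + s) * B (j + s)) ≡ K * Q s i j
  binomialSum-Q zero    i j h K eq = trans (eq 0 0 refl) (sym (ℕ.*-identityʳ K))
  binomialSum-Q (suc s) i j h K eq = begin
    (S₁ + S₂) * (A (i + suc s) * B (j + suc s))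
      ≡⟨ cong₂ (λ x y → (S₁ + S₂) * (x * y)) A-last (cong B (ℕ.+-suc j s)) ⟩
    (S₁ + S₂) * (a (i + s) * A (i + s) * (b (j + s) * B (j + s)))
      ≡⟨ split S₁ S₂ (a (i + s)) (A (i + s)) (b (j + s)) (B (j + s)) ⟩
    b (j + s) * (S₁ * (a (i + s) * A (i + s) * B (j + s))) + a (i + s) * (S₂ * (A (i + s) * (b (j + s) * B (j + s))))
      ≡⟨ cong₂ (λ x y → b (j + s) * x + a (i + s) * y)
           (trans (cong (λ x → S₁ * (x * B (j + s))) (sym (A-suc (i + s))))
                  (binomialSum-Q s (suc i) j _ K λ r t r+t≡s →
                     trans (cong (λ x → h (suc r) t * (A x * B (j + t))) (sym (ℕ.+-suc i r)))
                           (eq (suc r) t (cong suc r+t≡s))))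
           (binomialSum-Q s i (suc j) _ K λ r t r+t≡s →
              trans (cong (λ x → h r (suc t) * (A (i + r) * B x)) (sym (ℕ.+-suc j t)))
                    (eq r (suc t) (trans (ℕ.+-suc r t) (cong suc r+t≡s)))) ⟩
    b (j + s) * (K * Q s (suc i) j) + a (i + s) * (K * Q s i (suc j))
      ≡⟨ collect (b (j + s)) K (Q s (suc i) j) (a (i + s)) (Q s i (suc j)) ⟩
    K * Q (suc s) i j ∎
    where
    open ≡-Reasoning
    S₁ = binomialSum s (λ r t → h (suc r) t)
    S₂ = binomialSum s (λ r t → h r (suc t))
    A-last : A (i + suc s) ≡ a (i + s) * A (i + s)
    A-last = trans (cong A (ℕ.+-suc i s)) (A-suc (i + s))
    split : ∀ x y a A b B → (x + y) * (a * A * (b * B)) ≡ b * (x * (a * A * B)) + a * (y * (A * (b * B)))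
    split = solve-∀
    collect : ∀ b K p a q → b * (K * p) + a * (K * q) ≡ K * (b * p + a * q)
    collect = solve-∀

  -- Stands for F (i + t) / F i when `f n` is F (n + 1) / F n, which turns quotients of values of
  -- `A` and of `B` into natural numbers.
  rising : (ℕ → ℕ) → ℕ → ℕ → ℕ
  rising f i zero    = 1
  rising f i (suc t) = f (i + t) * rising f i t

  rising-* : ∀ {f F : ℕ → ℕ} → (∀ n → F (suc n) ≡ f n * F n) → ∀ i t → rising f i t * F i ≡ F (i + t)
  rising-* {F = F} F-suc i zero = trans (ℕ.*-identityˡ (F i)) (cong F (sym (ℕ.+-identityʳ i)))
  rising-* {f} {F} F-suc i (suc t) = begin
    f (i + t) * rising f i t * F i   ≡⟨ ℕ.*-assoc (f (i + t)) (rising f i t) (F i) ⟩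
    f (i + t) * (rising f i t * F i) ≡⟨ cong (f (i + t) *_) (rising-* F-suc i t) ⟩
    f (i + t) * F (i + t)            ≡⟨ F-suc (i + t) ⟨
    F (suc (i + t))                  ≡⟨ cong F (ℕ.+-suc i t) ⟨
    F (i + suc t)                    ∎
    where open ≡-Reasoning

  oddFactorial-nonZero : ∀ i → NonZero (oddFactorial i)
  oddFactorial-nonZero zero    = _
  oddFactorial-nonZero (suc i) = ℕ.m*n≢0 (3 + 2 * i) (oddFactorial i) {{_}} {{oddFactorial-nonZero i}}

  tᵒ-formula : ∀ m → tᵒ (4 * suc m + 1) * (A m * B m) ≡
    (2 + 2 * m) * (oddFactorial m * oddFactorial (2 + 2 * m)) * Q m 0 0
  tᵒ-formula m = begin
    tᵒ (4 * suc m + 1) * K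
      ≡⟨ cong (λ n → tᵒ n * K) (size m) ⟩
    tᵒ n * K
      ≡⟨ cong (_* K) (trans (tᵒ-weight n) (weight-expansion n (1 + 2 * suc m) (_% 2) n<2J)) ⟩
    ∑< (1 + 2 * suc m) (λ j → involutionsWith n j * (j % 2)) * K
      ≡⟨ cong (_* K) (trans (∑<-odd (suc m) (involutionsWith n)) (∑<-antiSum m (λ j → involutionsWith n (1 + 2 * j)))) ⟩
    antiSum m (λ _ j → involutionsWith n (1 + 2 * j)) * K
      ≡⟨ antiSum-*ʳ m _ K ⟩
    antiSum m (λ _ j → involutionsWith n (1 + 2 * j) * K)
      ≡⟨ antiSum-cong m term ⟩
    antiSum m (λ i j → choose i j * h i j * Ω)
      ≡⟨ antiSum-*ʳ m _ Ω ⟨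
    antiSum m (λ i j → choose i j * h i j) * Ω
      ≡⟨ cong (_* Ω) (trans (antiSum-choose m h) binomialSum-h) ⟩
    Q m 0 0 * Ω
      ≡⟨ ℕ.*-comm (Q m 0 0) Ω ⟩
    Ω * Q m 0 0 ∎
    where
    open ≡-Reasoning
    n = 1 + 2 * (2 + 2 * m)
    K = A m * B m
    Ω = (2 + 2 * m) * (oddFactorial m * oddFactorial (2 + 2 * m))
    -- For i + j = m this is K / (A i * B j).
    h : ℕ → ℕ → ℕ
    h i j = rising a i j * rising b j i
    size : ∀ m → 4 * (1 + m) + 1 ≡ 1 + 2 * (2 + 2 * m)
    size = solve-∀
    -- The range j ≤ 2m + 2 is exact for n = 4m + 5, and its odd members are 1 + 2j with j ≤ m.
    n<2J : n < 2 * (1 + 2 * suc m)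
    n<2J = subst (n <_) (double m) (ℕ.n<1+n n)
      where
      double : ∀ m → 1 + (1 + 2 * (2 + 2 * m)) ≡ 2 * (1 + 2 * (1 + m))
      double = solve-∀
    h-AB : ∀ i j → i + j ≡ m → h i j * (A i * B j) ≡ K
    h-AB i j i+j≡m = trans (swap (rising a i j) (rising b j i) (A i) (B j))
      (cong₂ _*_ (trans (rising-* {a} {A} A-suc i j) (cong A i+j≡m))
                 (trans (rising-* {b} {B} (λ _ → refl) j i) (cong B (trans (ℕ.+-comm j i) i+j≡m))))
      where
      swap : ∀ x y u v → x * y * (u * v) ≡ (x * u) * (y * v)
      swap = solve-∀
    binomialSum-h : binomialSum m h ≡ Q m 0 0
    binomialSum-h = ℕ.*-cancelˡ-≡ _ _ K {{ℕ.m*n≢0 (A m) (B m) {{ℕ.m*n≢0 (B m) (B (1 + 2 * m)) {{oddFactorial-nonZero m}} {{oddFactorial-nonZero (1 + 2 * m)}}}} {{oddFactorial-nonZero m}}}}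
      (trans (ℕ.*-comm K _) (binomialSum-Q m 0 0 h K h-AB))
    term : ∀ i j → i + j ≡ m → involutionsWith n (1 + 2 * j) * K ≡ choose i j * h i j * Ω
    term i j i+j≡m = begin
      N * K                                ≡⟨ cong (N *_) (h-AB i j i+j≡m) ⟨
      N * (h i j * (A i * B j))            ≡⟨ left N (h i j) (A i * B j) ⟩
      h i j * (N * (A i * B j))            ≡⟨ cong (h i j *_) (involutionsWith-odd m i j i+j≡m) ⟩
      h i j * (Ω * choose i j)             ≡⟨ right (h i j) Ω (choose i j) ⟩
      choose i j * h i j * Ω               ∎
      where
      N = involutionsWith n (1 + 2 * j)
      left : ∀ n h x → n * (h * x) ≡ h * (n * x)
      left = solve-∀
      right : ∀ h o c → h * (o * c) ≡ c * h * o
      right = solve-∀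

open Counting using (a; b; A; B; Q; oddFactorial; tᵒ-formula)

module NewtonSeries where

  open import Data.Integer using (ℤ; +_; -1ℤ; _+_; _*_; -_; ∣_∣)
  import Data.Integer.Properties as ℤ
  open import Data.Integer.Divisibility.Signed using (divides; ∣ᵤ⇒∣)
  open import Data.Integer.Tactic.RingSolver using (solve-∀)

  -- Functions in the basis 2ʳ (i choose r), and multiplication by linear polynomials.

  Seq : Set
  Seq = ℕ → ℤ

  -- c encodes the function i ↦ Σᵣ cᵣ 2ʳ (i choose r), whose shift i ↦ i + 1 is c ↦ c + 2 (c ∘ suc).
  eval : Seq → ℕ → ℤ
  eval c zero    = c 0
  eval c (suc i) = eval (λ r → c r + + 2 * c (suc r)) i

  eval-cong : ∀ {c d : Seq} → (∀ r → c r ≡ d r) → ∀ i → eval c i ≡ eval d i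
  eval-cong c≗d zero    = c≗d 0
  eval-cong c≗d (suc i) = eval-cong (λ r → cong₂ (λ x y → x + + 2 * y) (c≗d r) (c≗d (suc r))) i

  eval-+ : ∀ c d i → eval (λ r → c r + d r) i ≡ eval c i + eval d i
  eval-+ c d zero    = refl
  eval-+ c d (suc i) = trans (eval-cong (λ r → swap (c r) (d r) (c (suc r)) (d (suc r))) i) (eval-+ _ _ i)
    where
    swap : ∀ x y z w → x + y + + 2 * (z + w) ≡ (x + + 2 * z) + (y + + 2 * w)
    swap = solve-∀

  eval-* : ∀ k c i → eval (λ r → k * c r) i ≡ k * eval c i
  eval-* k c zero    = refl
  eval-* k c (suc i) = trans (eval-cong (λ r → factor k (c r) (c (suc r))) i) (eval-* k _ i)
    where
    factor : ∀ k x y → k * x + + 2 * (k * y) ≡ k * (x + + 2 * y)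
    factor = solve-∀

  eval-suc : ∀ c i → eval c (suc i) ≡ eval c i + + 2 * eval (c ∘ suc) i
  eval-suc c i = trans (eval-+ c _ i) (cong (_+_ (eval c i)) (eval-* (+ 2) (c ∘ suc) i))

  -- Multiplication by 2i, from i (i choose r) = r (i choose r) + (r + 1) (i choose r + 1). The
  -- factor `suc r` at index `suc r` is what later confines the supports.
  T : Seq → Seq
  T c zero    = + 0
  T c (suc r) = + suc r * (c r + + 2 * c (suc r))

  eval-T : ∀ c i → eval (T c) i ≡ + 2 * + i * eval c i
  eval-T c zero    = refl
  eval-T c (suc i) = begin
    eval (λ r → T c r + + 2 * T c (suc r)) i      ≡⟨ eval-cong commute i ⟩
    eval (λ r → T c⁺ r + + 2 * c⁺ r) i            ≡⟨ eval-+ (T c⁺) _ i ⟩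
    eval (T c⁺) i + eval (λ r → + 2 * c⁺ r) i     ≡⟨ cong₂ _+_ (eval-T c⁺ i) (eval-* (+ 2) c⁺ i) ⟩
    + 2 * + i * eval c⁺ i + + 2 * eval c⁺ i        ≡⟨ collect (+ i) (eval c⁺ i) ⟩
    + 2 * (+ 1 + + i) * eval c⁺ i                  ∎
    where
    open ≡-Reasoning
    c⁺ : Seq
    c⁺ r = c r + + 2 * c (suc r)
    collect : ∀ i e → + 2 * i * e + + 2 * e ≡ + 2 * (+ 1 + i) * e
    collect = solve-∀
    commute₀ : ∀ x y → + 0 + + 2 * (+ 1 * (x + + 2 * y)) ≡ + 0 + + 2 * (x + + 2 * y)
    commute₀ = solve-∀
    commute₁ : ∀ r x y z → (+ 1 + r) * (x + + 2 * y) + + 2 * ((+ 2 + r) * (y + + 2 * z)) ≡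
               (+ 1 + r) * (x + + 2 * y + + 2 * (y + + 2 * z)) + + 2 * (y + + 2 * z)
    commute₁ = solve-∀
    -- The identity 2 (i + 1) = 2i + 2 on the level of coefficients: `c⁺` encodes the shifted
    -- function.
    commute : ∀ r → T c r + + 2 * T c (suc r) ≡ T c⁺ r + + 2 * c⁺ r
    commute zero    = commute₀ (c 0) (c 1)
    commute (suc r) = commute₁ (+ r) (c r) (c (suc r)) (c (2 ℕ.+ r))

  U : ℤ → Seq → Seq
  U s c r = T c r + + 2 * s * c r

  eval-U : ∀ s c i → eval (U s c) i ≡ (+ 2 * + i + + 2 * s) * eval c i
  eval-U s c i = begin
    eval (U s c) i                                ≡⟨ eval-+ (T c) _ i ⟩
    eval (T c) i + eval (λ r → + 2 * s * c r) i    ≡⟨ cong₂ _+_ (eval-T c i) (eval-* (+ 2 * s) c i) ⟩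
    + 2 * + i * eval c i + + 2 * s * eval c i       ≡⟨ ℤ.*-distribʳ-+ (eval c i) (+ 2 * + i) (+ 2 * s) ⟨
    (+ 2 * + i + + 2 * s) * eval c i                ∎
    where open ≡-Reasoning

  -- The recurrence for `Q` as an operator on coefficients.

  -- Half of the recurrence for Q: with u = 2 (i + s), twice 2u³ + 18u² + 53u + 53 + m + s
  -- is a (i + s) + (2m + 1 - 2i), and 2m + 1 - 2i = b (j + s) when m = i + j + s + 1.
  step : ℤ → ℤ → Seq → Seq
  step m s c r =
    + 2 * U s (U s (U s c)) r + (+ 18 * U s (U s c) r + (+ 53 * U s c r +
    ((+ 53 + m + s) * c r + ((+ 2 * m + + 1) * c (suc r) + -1ℤ * T (c ∘ suc) r))))

  eval-step : ∀ m s c i → let u = + 2 * + i + + 2 * s ; e = eval c i ; d = eval (c ∘ suc) i in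
    eval (step m s c) i ≡
    + 2 * (u * (u * (u * e))) + (+ 18 * (u * (u * e)) + (+ 53 * (u * e) +
    ((+ 53 + m + s) * e + ((+ 2 * m + + 1) * d + -1ℤ * (+ 2 * + i * d)))))
  eval-step m s c i =
    combine (+ 2) (U s (U s (U s c))) U³ (combine (+ 18) (U s (U s c)) U² (combine (+ 53) (U s c) (eval-U s c i)
    (combine (+ 53 + m + s) c refl (combine (+ 2 * m + + 1) (c ∘ suc) refl
    (trans (eval-* -1ℤ (T (c ∘ suc)) i) (cong (-1ℤ *_) (eval-T (c ∘ suc) i)))))))
    where
    combine : ∀ k (x : Seq) {y : Seq} {e f} → eval x i ≡ e → eval y i ≡ f → eval (λ r → k * x r + y r) i ≡ k * e + f
    combine k x {y} refl refl = trans (eval-+ _ y i) (cong (_+ eval y i) (eval-* k x i))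
    U² = trans (eval-U s (U s c) i) (cong ((+ 2 * + i + + 2 * s) *_) (eval-U s c i))
    U³ = trans (eval-U s (U s (U s c)) i) (cong ((+ 2 * + i + + 2 * s) *_) U²)

  seq : ℤ → ℤ → ℤ → ℤ → Seq
  seq x y z w 0 = x
  seq x y z w 1 = y
  seq x y z w 2 = z
  seq x y z w 3 = w
  seq x y z w (suc (suc (suc (suc r)))) = + 0

  -- Once `m` and `s` are fixed, i + j + s = m makes `Q s i j` a function of `i` alone; this
  -- sequence encodes it divided by 2ˢ.
  coeffs : ℕ → ℕ → Seq
  coeffs m zero    = seq (+ 1) (+ 0) (+ 0) (+ 0)
  coeffs m (suc s) = step (+ m) (+ s) (coeffs m s)

  pos-b : ∀ j → + b j ≡ + 3 + + 2 * + j
  pos-b j = cong (_+_ (+ 3)) (ℤ.pos-* 2 j)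

  pos-a : ∀ i → + a i ≡ (+ 3 + + 2 * + i) * (+ 5 + + 4 * + i) * (+ 7 + + 4 * + i)
  pos-a i = begin
    + a i
      ≡⟨ ℤ.pos-* ((3 ℕ.+ 2 ℕ.* i) ℕ.* (5 ℕ.+ 4 ℕ.* i)) (7 ℕ.+ 4 ℕ.* i) ⟩
    + ((3 ℕ.+ 2 ℕ.* i) ℕ.* (5 ℕ.+ 4 ℕ.* i)) * + (7 ℕ.+ 4 ℕ.* i)
      ≡⟨ cong₂ _*_ (trans (ℤ.pos-* (3 ℕ.+ 2 ℕ.* i) (5 ℕ.+ 4 ℕ.* i))
           (cong₂ _*_ (cong (_+_ (+ 3)) (ℤ.pos-* 2 i)) (cong (_+_ (+ 5)) (ℤ.pos-* 4 i))))
           (cong (_+_ (+ 7)) (ℤ.pos-* 4 i)) ⟩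
    (+ 3 + + 2 * + i) * (+ 5 + + 4 * + i) * (+ 7 + + 4 * + i) ∎
    where open ≡-Reasoning

  eval-coeffs-zero : ∀ m i → eval (coeffs m 0) i ≡ + 1
  eval-coeffs-zero m zero    = refl
  eval-coeffs-zero m (suc i) = trans (eval-cong const i) (eval-coeffs-zero m i)
    where
    const : ∀ r → coeffs m 0 r + + 2 * coeffs m 0 (suc r) ≡ coeffs m 0 r
    const 0 = refl
    const 1 = refl
    const 2 = refl
    const 3 = refl
    const (suc (suc (suc (suc r)))) = refl

  Q-eval : ∀ s i j m → i ℕ.+ j ℕ.+ s ≡ m → + Q s i j ≡ + (2 ℕ.^ s) * eval (coeffs m s) i
  Q-eval zero    i j m i+j+s≡m = sym (trans (ℤ.*-identityˡ _) (eval-coeffs-zero m i))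
  Q-eval (suc s) i j m refl = begin
    + Q (suc s) i j
      ≡⟨ ℤ.pos-+ (b (j ℕ.+ s) ℕ.* Q s (suc i) j) _ ⟩
    + (b (j ℕ.+ s) ℕ.* Q s (suc i) j) + + (a (i ℕ.+ s) ℕ.* Q s i (suc j))
      ≡⟨ cong₂ _+_ (ℤ.pos-* (b (j ℕ.+ s)) (Q s (suc i) j)) (ℤ.pos-* (a (i ℕ.+ s)) (Q s i (suc j))) ⟩
    + b (j ℕ.+ s) * + Q s (suc i) j + + a (i ℕ.+ s) * + Q s i (suc j)
      ≡⟨ cong₂ _+_
           (cong₂ _*_ (pos-b (j ℕ.+ s)) (trans (Q-eval s (suc i) j m (sym (ℕ.+-suc (i ℕ.+ j) s))) (cong (P *_) (eval-suc c i))))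
           (cong₂ _*_ (pos-a (i ℕ.+ s)) (Q-eval s i (suc j) m (trans (cong (ℕ._+ s) (ℕ.+-suc i j)) (sym (ℕ.+-suc (i ℕ.+ j) s))))) ⟩
    (+ 3 + + 2 * (+ j + + s)) * (P * (e + + 2 * d)) +
      (+ 3 + + 2 * (+ i + + s)) * (+ 5 + + 4 * (+ i + + s)) * (+ 7 + + 4 * (+ i + + s)) * (P * e)
      ≡⟨ halve (+ i) (+ j) (+ s) P e d ⟩
    + 2 * P * _
      ≡⟨ cong (+ 2 * P *_) (sym (eval-step (+ m) (+ s) c i)) ⟩
    + 2 * P * eval (coeffs m (suc s)) i
      ≡⟨ cong (_* eval (coeffs m (suc s)) i) (ℤ.pos-* 2 (2 ℕ.^ s)) ⟨
    + (2 ℕ.^ suc s) * eval (coeffs m (suc s)) i ∎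
    where
    open ≡-Reasoning
    c = coeffs m s
    P = + (2 ℕ.^ s)
    e = eval c i
    d = eval (c ∘ suc) i
    -- The factor 2 comes from two places: a + b is even in front of `e`, and the shift supplies the
    -- 2 in front of `d`.
    halve : ∀ i j s p e d → let m = i + j + (+ 1 + s) ; u = + 2 * i + + 2 * s in
      (+ 3 + + 2 * (j + s)) * (p * (e + + 2 * d)) + (+ 3 + + 2 * (i + s)) * (+ 5 + + 4 * (i + s)) * (+ 7 + + 4 * (i + s)) * (p * e) ≡
      + 2 * p * (+ 2 * (u * (u * (u * e))) + (+ 18 * (u * (u * e)) + (+ 53 * (u * e) +
        ((+ 53 + m + s) * e + ((+ 2 * m + + 1) * d + -1ℤ * (+ 2 * i * d))))))
    halve = solve-∀

  -- Congruences of coefficient sequences modulo a divisor of 4.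

  module Congruence (n q : ℤ) (n*q≡4 : n * q ≡ + 4) where

    infix 4 _≈_ _≋_

    record _≈_ (x y : ℤ) : Set where
      constructor _,_
      field
        quotient : ℤ
        equality : x ≡ y + n * quotient

    ≈-reflexive : ∀ {x y} → x ≡ y → x ≈ y
    ≈-reflexive {x} refl = + 0 , vanish x n
      where
      vanish : ∀ x n → x ≡ x + n * + 0
      vanish = solve-∀

    ≈-trans : ∀ {x y z} → x ≈ y → y ≈ z → x ≈ z
    ≈-trans {z = z} (u , refl) (v , refl) = v + u , assoc z n v u
      where
      assoc : ∀ z n v u → z + n * v + n * u ≡ z + n * (v + u)
      assoc = solve-∀

    +-cong : ∀ {x x′ y y′} → x ≈ x′ → y ≈ y′ → x + y ≈ x′ + y′
    +-cong {x′ = x} {y′ = y} (u , refl) (v , refl) = u + v , swap x y n u v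
      where
      swap : ∀ x y n u v → x + n * u + (y + n * v) ≡ x + y + n * (u + v)
      swap = solve-∀

    *-cong : ∀ k {x y} → x ≈ y → k * x ≈ k * y
    *-cong k {y = y} (u , refl) = k * u , factor k y n u
      where
      factor : ∀ k y n u → k * (y + n * u) ≡ k * y + n * (k * u)
      factor = solve-∀

    -- As `n` divides 4, each computation modulo 4 below serves both n = 4 and n = 2.
    ≈-mod4 : ∀ {x y} w → x ≡ y + + 4 * w → x ≈ y
    ≈-mod4 {y = y} w refl = q * w , cong (_+_ y) (trans (cong (_* w) (sym n*q≡4)) (ℤ.*-assoc n q w))

    record _≋_ (c d : Seq) : Set where
      constructor pointwise
      field at : ∀ r → c r ≈ d r
    open _≋_

    ≋-trans : ∀ {c d e} → c ≋ d → d ≋ e → c ≋ e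
    ≋-trans c≋d d≋e .at r = ≈-trans (c≋d .at r) (d≋e .at r)

    T-cong : ∀ {c d} → c ≋ d → T c ≋ T d
    T-cong c≋d .at zero    = ≈-reflexive refl
    T-cong c≋d .at (suc r) = *-cong (+ suc r) (+-cong (c≋d .at r) (*-cong (+ 2) (c≋d .at (suc r))))

    U-cong : ∀ s {c d} → c ≋ d → U s c ≋ U s d
    U-cong s c≋d .at r = +-cong (T-cong c≋d .at r) (*-cong (+ 2 * s) (c≋d .at r))

    step-cong : ∀ m s {c d} → c ≋ d → step m s c ≋ step m s d
    step-cong m s c≋d .at r =
      +-cong (*-cong (+ 2) (U-cong s (U-cong s (U-cong s c≋d)) .at r))
      (+-cong (*-cong (+ 18) (U-cong s (U-cong s c≋d) .at r))
      (+-cong (*-cong (+ 53) (U-cong s c≋d .at r))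
      (+-cong (*-cong (+ 53 + m + s) (c≋d .at r))
      (+-cong (*-cong (+ 2 * m + + 1) (c≋d .at (suc r)))
              (*-cong -1ℤ (T-cong (pointwise λ r → c≋d .at (suc r)) .at r))))))

    seq-cong : ∀ {x x′ y y′ z z′ w w′} → x ≈ x′ → y ≈ y′ → z ≈ z′ → w ≈ w′ → seq x y z w ≋ seq x′ y′ z′ w′
    seq-cong x y z w .at 0 = x
    seq-cong x y z w .at 1 = y
    seq-cong x y z w .at 2 = z
    seq-cong x y z w .at 3 = w
    seq-cong x y z w .at (suc (suc (suc (suc r)))) = ≈-reflexive refl

    -- At index 4 the entry is 4 (w + 2 · 0), so modulo 4 nothing leaves the range r < 4.
    T-seq : ∀ x y z w → T (seq x y z w) ≋ seq (+ 0) (x + + 2 * y) (+ 2 * y) (+ 3 * z + + 2 * w)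
    T-seq x y z w .at 0 = ≈-reflexive refl
    T-seq x y z w .at 1 = ≈-reflexive (ℤ.*-identityˡ _)
    T-seq x y z w .at 2 = ≈-mod4 z (entry y z)
      where
      entry : ∀ y z → + 2 * (y + + 2 * z) ≡ + 2 * y + + 4 * z
      entry = solve-∀
    T-seq x y z w .at 3 = ≈-mod4 w (entry z w)
      where
      entry : ∀ z w → + 3 * (z + + 2 * w) ≡ + 3 * z + + 2 * w + + 4 * w
      entry = solve-∀
    T-seq x y z w .at 4 = ≈-mod4 w (entry w)
      where
      entry : ∀ w → + 4 * (w + + 2 * + 0) ≡ + 0 + + 4 * w
      entry = solve-∀
    T-seq x y z w .at (suc (suc (suc (suc (suc r))))) = ≈-reflexive (ℤ.*-zeroʳ (+ (5 ℕ.+ r)))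

    U-seq : ∀ s x y z w → U s (seq x y z w) ≋
      seq (+ 2 * s * x) (x + + 2 * y + + 2 * s * y) (+ 2 * y + + 2 * s * z) (+ 3 * z + + 2 * w + + 2 * s * w)
    U-seq s x y z w .at r = ≈-trans (+-cong (T-seq x y z w .at r) (≈-reflexive refl)) (≈-reflexive (entry r))
      where
      entry : ∀ r → seq (+ 0) (x + + 2 * y) (+ 2 * y) (+ 3 * z + + 2 * w) r + + 2 * s * seq x y z w r ≡
        seq (+ 2 * s * x) (x + + 2 * y + + 2 * s * y) (+ 2 * y + + 2 * s * z) (+ 3 * z + + 2 * w + + 2 * s * w) r
      entry 0 = ℤ.+-identityˡ _
      entry 1 = refl
      entry 2 = refl
      entry 3 = refl
      entry (suc (suc (suc (suc r)))) = trans (ℤ.+-identityˡ _) (ℤ.*-zeroʳ (+ 2 * s))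

    double : Seq → Seq
    double c r = + 2 * c r

    -- Modulo 2 both `U s` and `T` move the entry at r to r + 1 with the factor r + 1; applying this
    -- twice gives (r + 1)(r + 2), which is even.
    U²-seq : ∀ s x y z w → ∃ λ e → U s (U s (seq x y z w)) ≋ double e
    U²-seq s x y z w = e , ≋-trans (U-cong s (U-seq s x y z w)) (≋-trans (U-seq s x′ y′ z′ w′) (pointwise (≈-reflexive ∘ entry)))
      where
      x′ = + 2 * s * x
      y′ = x + + 2 * y + + 2 * s * y
      z′ = + 2 * y + + 2 * s * z
      w′ = + 3 * z + + 2 * w + + 2 * s * w
      e = seq (s * x′) (s * x + y′ + s * y′) (y′ + s * z′) (+ 3 * (y + s * z) + w′ + s * w′)
      entry₀ : ∀ s x → + 2 * s * x ≡ + 2 * (s * x)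
      entry₀ = solve-∀
      entry₁ : ∀ s x y → + 2 * s * x + + 2 * y + + 2 * s * y ≡ + 2 * (s * x + y + s * y)
      entry₁ = solve-∀
      entry₂ : ∀ s y z → + 2 * y + + 2 * s * z ≡ + 2 * (y + s * z)
      entry₂ = solve-∀
      entry₃ : ∀ s y z w → + 3 * (+ 2 * y + + 2 * s * z) + + 2 * w + + 2 * s * w ≡ + 2 * (+ 3 * (y + s * z) + w + s * w)
      entry₃ = solve-∀
      entry : ∀ r → seq (+ 2 * s * x′) (x′ + + 2 * y′ + + 2 * s * y′) (+ 2 * y′ + + 2 * s * z′) (+ 3 * z′ + + 2 * w′ + + 2 * s * w′) r ≡ double e r
      entry 0 = entry₀ s x′
      entry 1 = entry₁ s x y′
      entry 2 = entry₂ s y′ z′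
      entry 3 = entry₃ s y z w′
      entry (suc (suc (suc (suc r)))) = refl

    U-double : ∀ s e → U s (double e) ≋ double (U s e)
    U-double s e .at zero    = ≈-reflexive (factor s (e 0))
      where
      factor : ∀ s x → + 0 + + 2 * s * (+ 2 * x) ≡ + 2 * (+ 0 + + 2 * s * x)
      factor = solve-∀
    U-double s e .at (suc r) = ≈-reflexive (factor s (+ suc r) (e r) (e (suc r)))
      where
      factor : ∀ s r x y → r * (+ 2 * x + + 2 * (+ 2 * y)) + + 2 * s * (+ 2 * y) ≡ + 2 * (r * (x + + 2 * y) + + 2 * s * y)
      factor = solve-∀

    multiple-of-4 : ∀ k x → + 4 * k * x ≈ + 0
    multiple-of-4 k x = ≈-mod4 (k * x) (entry k x)
      where
      entry : ∀ k x → + 4 * k * x ≡ + 0 + + 4 * (k * x)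
      entry = solve-∀

    -- Since U² is even on such sequences, 2U³ and 18U² vanish modulo 4, while 53U is congruent to
    -- U. Only the terms linear in `U` and the shifted part survive.
    step-seq : ∀ m s x y z w → step m s (seq x y z w) ≋ seq
      ((+ 1 + m + + 3 * s) * x + (+ 2 * m + + 1) * y)
      (x + y + (+ 1 + m + + 3 * s) * y + (+ 2 * m + + 1) * z + + 2 * z)
      (+ 2 * y + (+ 3 + m + + 3 * s) * z + (+ 2 * m + + 1) * w)
      (+ 3 * z + (m + + 3 * s) * w)
    step-seq m s x y z w with e , U²≋ ← U²-seq s x y z w =
      ≋-trans (pointwise λ r → +-cong (drop-U³ r) (+-cong (drop-U² r) (+-cong (drop-52 r)
        (+-cong (≈-reflexive {(+ 53 + m + s) * seq x y z w r} refl)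
        (+-cong (≈-reflexive {(+ 2 * m + + 1) * seq x y z w (suc r)} refl) (*-cong -1ℤ (T-tail .at r)))))))
      (≋-trans (pointwise λ r → ≈-reflexive (collect (+ 53 + m + s) (+ 2 * m + + 1) x y z w
          (+ 2 * s * x) (x + + 2 * y + + 2 * s * y) (+ 2 * y + + 2 * s * z) (+ 3 * z + + 2 * w + + 2 * s * w)
          (+ 0) (y + + 2 * z) (+ 2 * z) (+ 3 * w + + 2 * + 0) r))
        (seq-cong (entry₀ m s x y) (entry₁ m s x y z) (entry₂ m s y z w) (entry₃ m s z w)))
      where
      T-tail : T (seq x y z w ∘ suc) ≋ seq (+ 0) (y + + 2 * z) (+ 2 * z) (+ 3 * w + + 2 * + 0)
      T-tail = ≋-trans (T-cong (pointwise λ r → ≈-reflexive (tail r))) (T-seq y z w (+ 0))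
        where
        tail : ∀ r → seq x y z w (suc r) ≡ seq y z w (+ 0) r
        tail 0 = refl
        tail 1 = refl
        tail 2 = refl
        tail 3 = refl
        tail (suc (suc (suc (suc r)))) = refl
      drop-U³ : ∀ r → + 2 * U s (U s (U s (seq x y z w))) r ≈ + 0
      drop-U³ r = ≈-trans (*-cong (+ 2) (≈-trans (U-cong s U²≋ .at r) (U-double s e .at r)))
                          (≈-trans (≈-reflexive (regroup (U s e r))) (multiple-of-4 (+ 1) (U s e r)))
        where
        regroup : ∀ f → + 2 * (+ 2 * f) ≡ + 4 * + 1 * f
        regroup = solve-∀
      drop-U² : ∀ r → + 18 * U s (U s (seq x y z w)) r ≈ + 0
      drop-U² r = ≈-trans (*-cong (+ 18) (U²≋ .at r))
                          (≈-trans (≈-reflexive (regroup (e r))) (multiple-of-4 (+ 9) (e r)))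
        where
        regroup : ∀ f → + 18 * (+ 2 * f) ≡ + 4 * + 9 * f
        regroup = solve-∀
      drop-52 : ∀ r → + 53 * U s (seq x y z w) r ≈
        seq (+ 2 * s * x) (x + + 2 * y + + 2 * s * y) (+ 2 * y + + 2 * s * z) (+ 3 * z + + 2 * w + + 2 * s * w) r
      drop-52 r = ≈-trans (≈-mod4 (+ 13 * U s (seq x y z w) r) (regroup (U s (seq x y z w) r))) (U-seq s x y z w .at r)
        where
        regroup : ∀ u → + 53 * u ≡ u + + 4 * (+ 13 * u)
        regroup = solve-∀
      collect : ∀ k l x y z w p₀ p₁ p₂ p₃ q₀ q₁ q₂ q₃ r →
        + 0 + (+ 0 + (seq p₀ p₁ p₂ p₃ r + (k * seq x y z w r + (l * seq x y z w (suc r) + -1ℤ * seq q₀ q₁ q₂ q₃ r)))) ≡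
        seq (+ 0 + (+ 0 + (p₀ + (k * x + (l * y + -1ℤ * q₀))))) (+ 0 + (+ 0 + (p₁ + (k * y + (l * z + -1ℤ * q₁)))))
            (+ 0 + (+ 0 + (p₂ + (k * z + (l * w + -1ℤ * q₂))))) (+ 0 + (+ 0 + (p₃ + (k * w + (l * + 0 + -1ℤ * q₃))))) r
      collect k l x y z w p₀ p₁ p₂ p₃ q₀ q₁ q₂ q₃ 0 = refl
      collect k l x y z w p₀ p₁ p₂ p₃ q₀ q₁ q₂ q₃ 1 = refl
      collect k l x y z w p₀ p₁ p₂ p₃ q₀ q₁ q₂ q₃ 2 = refl
      collect k l x y z w p₀ p₁ p₂ p₃ q₀ q₁ q₂ q₃ 3 = refl
      collect k l x y z w p₀ p₁ p₂ p₃ q₀ q₁ q₂ q₃ (suc (suc (suc (suc r)))) = zeros k l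
        where
        zeros : ∀ k l → + 0 + (+ 0 + (+ 0 + (k * + 0 + (l * + 0 + -1ℤ * + 0)))) ≡ + 0
        zeros = solve-∀
      entry₀ : ∀ m s x y → + 0 + (+ 0 + (+ 2 * s * x + ((+ 53 + m + s) * x + ((+ 2 * m + + 1) * y + -1ℤ * + 0)))) ≈
        (+ 1 + m + + 3 * s) * x + (+ 2 * m + + 1) * y
      entry₀ m s x y = ≈-mod4 (+ 13 * x) (identity m s x y)
        where
        identity : ∀ m s x y → + 0 + (+ 0 + (+ 2 * s * x + ((+ 53 + m + s) * x + ((+ 2 * m + + 1) * y + -1ℤ * + 0)))) ≡
          (+ 1 + m + + 3 * s) * x + (+ 2 * m + + 1) * y + + 4 * (+ 13 * x)
        identity = solve-∀
      entry₁ : ∀ m s x y z → + 0 + (+ 0 + (x + + 2 * y + + 2 * s * y + ((+ 53 + m + s) * y + ((+ 2 * m + + 1) * z + -1ℤ * (y + + 2 * z))))) ≈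
        x + y + (+ 1 + m + + 3 * s) * y + (+ 2 * m + + 1) * z + + 2 * z
      entry₁ m s x y z = ≈-mod4 (+ 13 * y + -1ℤ * z) (identity m s x y z)
        where
        identity : ∀ m s x y z → + 0 + (+ 0 + (x + + 2 * y + + 2 * s * y + ((+ 53 + m + s) * y + ((+ 2 * m + + 1) * z + -1ℤ * (y + + 2 * z))))) ≡
          x + y + (+ 1 + m + + 3 * s) * y + (+ 2 * m + + 1) * z + + 2 * z + + 4 * (+ 13 * y + -1ℤ * z)
        identity = solve-∀
      entry₂ : ∀ m s y z w → + 0 + (+ 0 + (+ 2 * y + + 2 * s * z + ((+ 53 + m + s) * z + ((+ 2 * m + + 1) * w + -1ℤ * (+ 2 * z))))) ≈
        + 2 * y + (+ 3 + m + + 3 * s) * z + (+ 2 * m + + 1) * w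
      entry₂ m s y z w = ≈-mod4 (+ 12 * z) (identity m s y z w)
        where
        identity : ∀ m s y z w → + 0 + (+ 0 + (+ 2 * y + + 2 * s * z + ((+ 53 + m + s) * z + ((+ 2 * m + + 1) * w + -1ℤ * (+ 2 * z))))) ≡
          + 2 * y + (+ 3 + m + + 3 * s) * z + (+ 2 * m + + 1) * w + + 4 * (+ 12 * z)
        identity = solve-∀
      entry₃ : ∀ m s z w → + 0 + (+ 0 + (+ 3 * z + + 2 * w + + 2 * s * w + ((+ 53 + m + s) * w + ((+ 2 * m + + 1) * + 0 + -1ℤ * (+ 3 * w + + 2 * + 0))))) ≈
        + 3 * z + (m + + 3 * s) * w
      entry₃ m s z w = ≈-mod4 (+ 13 * w) (identity m s z w)
        where
        identity : ∀ m s z w → + 0 + (+ 0 + (+ 3 * z + + 2 * w + + 2 * s * w + ((+ 53 + m + s) * w + ((+ 2 * m + + 1) * + 0 + -1ℤ * (+ 3 * w + + 2 * + 0))))) ≡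
          + 3 * z + (m + + 3 * s) * w + + 4 * (+ 13 * w)
        identity = solve-∀

  -- Evolution of the coefficients: modulo 2 for even m, modulo 4 for odd m.

  module Mod2 = Congruence (+ 2) (+ 2) refl
  module Mod4 = Congruence (+ 4) (+ 1) refl

  -- For even m, entries 0 and 1 become (1 + s) x + y and x + s y + z modulo 2; with z = w = 0 the
  -- pairs (1, 0) and (1, 1) therefore alternate.
  even-step₁ : ∀ m s μ σ → m ≡ + 2 * μ → s ≡ + 2 * σ → step m s (seq (+ 1) (+ 0) (+ 0) (+ 0)) Mod2.≋ seq (+ 1) (+ 1) (+ 0) (+ 0)
  even-step₁ _ _ μ σ refl refl = ≋-trans (step-seq (+ 2 * μ) (+ 2 * σ) (+ 1) (+ 0) (+ 0) (+ 0))
    (seq-cong (μ + + 3 * σ , e₀ μ σ) (+ 0 , e₁ μ σ) (+ 0 , e₂ μ σ) (+ 0 , e₃ μ σ))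
    where
    open Mod2
    e₀ : ∀ μ σ → (+ 1 + + 2 * μ + + 3 * (+ 2 * σ)) * + 1 + (+ 2 * (+ 2 * μ) + + 1) * + 0 ≡ + 1 + + 2 * (μ + + 3 * σ)
    e₀ = solve-∀
    e₁ : ∀ μ σ → + 1 + + 0 + (+ 1 + + 2 * μ + + 3 * (+ 2 * σ)) * + 0 + (+ 2 * (+ 2 * μ) + + 1) * + 0 + + 2 * + 0 ≡ + 1 + + 2 * + 0
    e₁ = solve-∀
    e₂ : ∀ μ σ → + 2 * + 0 + (+ 3 + + 2 * μ + + 3 * (+ 2 * σ)) * + 0 + (+ 2 * (+ 2 * μ) + + 1) * + 0 ≡ + 0 + + 2 * + 0
    e₂ = solve-∀
    e₃ : ∀ μ σ → + 3 * + 0 + (+ 2 * μ + + 3 * (+ 2 * σ)) * + 0 ≡ + 0 + + 2 * + 0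
    e₃ = solve-∀

  even-step₂ : ∀ m s μ σ → m ≡ + 2 * μ → s ≡ + 1 + + 2 * σ → step m s (seq (+ 1) (+ 1) (+ 0) (+ 0)) Mod2.≋ seq (+ 1) (+ 0) (+ 0) (+ 0)
  even-step₂ _ _ μ σ refl refl = ≋-trans (step-seq (+ 2 * μ) (+ 1 + + 2 * σ) (+ 1) (+ 1) (+ 0) (+ 0))
    (seq-cong (+ 2 + + 3 * μ + + 3 * σ , e₀ μ σ) (+ 3 + μ + + 3 * σ , e₁ μ σ) (+ 1 , e₂ μ σ) (+ 0 , e₃ μ σ))
    where
    open Mod2
    e₀ : ∀ μ σ → (+ 1 + + 2 * μ + + 3 * (+ 1 + + 2 * σ)) * + 1 + (+ 2 * (+ 2 * μ) + + 1) * + 1 ≡ + 1 + + 2 * (+ 2 + + 3 * μ + + 3 * σ)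
    e₀ = solve-∀
    e₁ : ∀ μ σ → + 1 + + 1 + (+ 1 + + 2 * μ + + 3 * (+ 1 + + 2 * σ)) * + 1 + (+ 2 * (+ 2 * μ) + + 1) * + 0 + + 2 * + 0 ≡ + 0 + + 2 * (+ 3 + μ + + 3 * σ)
    e₁ = solve-∀
    e₂ : ∀ μ σ → + 2 * + 1 + (+ 3 + + 2 * μ + + 3 * (+ 1 + + 2 * σ)) * + 0 + (+ 2 * (+ 2 * μ) + + 1) * + 0 ≡ + 0 + + 2 * + 1
    e₂ = solve-∀
    e₃ : ∀ μ σ → + 3 * + 0 + (+ 2 * μ + + 3 * (+ 1 + + 2 * σ)) * + 0 ≡ + 0 + + 2 * + 0
    e₃ = solve-∀

  -- The multiplier 1 + m + 3s of entry 0 is even here, so the unknown `x` contributes a multiple of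
  -- 4 and the new entry 0 is known modulo 4.
  odd-step₁ : ∀ m s μ σ x y → m ≡ + 1 + + 2 * μ → s ≡ + 2 * σ →
    step m s (seq (+ 1 + + 2 * x) (+ 0) (+ 2 * y) (+ 0)) Mod4.≋
    seq (+ 2 * (+ 1 + μ + σ)) (+ 1 + + 2 * (x + y)) (+ 0) (+ 2 * y)
  odd-step₁ _ _ μ σ x y refl refl = ≋-trans (step-seq (+ 1 + + 2 * μ) (+ 2 * σ) (+ 1 + + 2 * x) (+ 0) (+ 2 * y) (+ 0))
    (seq-cong (σ + x * (+ 1 + μ + + 3 * σ) , e₀ μ σ x) (+ 2 * y + + 2 * (μ * y) , e₁ μ σ x y)
              ((+ 2 + μ + + 3 * σ) * y , e₂ μ σ y) (y , e₃ μ σ y))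
    where
    open Mod4
    e₀ : ∀ μ σ x → (+ 1 + (+ 1 + + 2 * μ) + + 3 * (+ 2 * σ)) * (+ 1 + + 2 * x) + (+ 2 * (+ 1 + + 2 * μ) + + 1) * + 0 ≡
         + 2 * (+ 1 + μ + σ) + + 4 * (σ + x * (+ 1 + μ + + 3 * σ))
    e₀ = solve-∀
    e₁ : ∀ μ σ x y → + 1 + + 2 * x + + 0 + (+ 1 + (+ 1 + + 2 * μ) + + 3 * (+ 2 * σ)) * + 0 +
         (+ 2 * (+ 1 + + 2 * μ) + + 1) * (+ 2 * y) + + 2 * (+ 2 * y) ≡
         + 1 + + 2 * (x + y) + + 4 * (+ 2 * y + + 2 * (μ * y))
    e₁ = solve-∀
    e₂ : ∀ μ σ y → + 2 * + 0 + (+ 3 + (+ 1 + + 2 * μ) + + 3 * (+ 2 * σ)) * (+ 2 * y) + (+ 2 * (+ 1 + + 2 * μ) + + 1) * + 0 ≡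
         + 0 + + 4 * ((+ 2 + μ + + 3 * σ) * y)
    e₂ = solve-∀
    e₃ : ∀ μ σ y → + 3 * (+ 2 * y) + (+ 1 + + 2 * μ + + 3 * (+ 2 * σ)) * + 0 ≡ + 2 * y + + 4 * y
    e₃ = solve-∀

  -- Entry 1 returns to 0 because the incoming entry 0 is known modulo 4: it meets the same residue
  -- 2 (1 + μ + σ), coming from (2 + m + 3s)(1 + 2 (x + y)), and the two add up to a multiple of 4.
  odd-step₂ : ∀ m s μ σ x y → m ≡ + 1 + + 2 * μ → s ≡ + 1 + + 2 * σ → ∃ λ x′ → ∃ λ y′ →
    step m s (seq (+ 2 * (+ 1 + μ + σ)) (+ 1 + + 2 * (x + y)) (+ 0) (+ 2 * y)) Mod4.≋
    seq (+ 1 + + 2 * x′) (+ 0) (+ 2 * y′) (+ 0)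
  odd-step₂ _ _ μ σ x y refl refl =
    -- The witnesses are read off from entries 0 and 2 of `step-seq`, which have the forms 1 + 2x′
    -- and 2y′.
    (+ 5 + + 2 * μ + + 6 * σ) * (+ 1 + μ + σ) + + 1 + + 2 * μ + (+ 3 + + 4 * μ) * (x + y) ,
    + 1 + + 2 * (x + y) + (+ 3 + + 4 * μ) * y ,
    ≋-trans (step-seq (+ 1 + + 2 * μ) (+ 1 + + 2 * σ) (+ 2 * (+ 1 + μ + σ)) (+ 1 + + 2 * (x + y)) (+ 0) (+ 2 * y))
      (seq-cong (+ 0 , e₀ μ σ (x + y)) (+ 2 + μ + + 2 * σ + (x + y) * (+ 3 + μ + + 3 * σ) , e₁ μ σ (x + y))
                (+ 0 , e₂ μ σ (x + y) y) ((+ 2 + μ + + 3 * σ) * y , e₃ μ σ y))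
    where
    open Mod4
    e₀ : ∀ μ σ z → (+ 1 + (+ 1 + + 2 * μ) + + 3 * (+ 1 + + 2 * σ)) * (+ 2 * (+ 1 + μ + σ)) + (+ 2 * (+ 1 + + 2 * μ) + + 1) * (+ 1 + + 2 * z) ≡
         + 1 + + 2 * ((+ 5 + + 2 * μ + + 6 * σ) * (+ 1 + μ + σ) + + 1 + + 2 * μ + (+ 3 + + 4 * μ) * z) + + 4 * + 0
    e₀ = solve-∀
    e₁ : ∀ μ σ z → + 2 * (+ 1 + μ + σ) + (+ 1 + + 2 * z) + (+ 1 + (+ 1 + + 2 * μ) + + 3 * (+ 1 + + 2 * σ)) * (+ 1 + + 2 * z) +
         (+ 2 * (+ 1 + + 2 * μ) + + 1) * + 0 + + 2 * + 0 ≡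
         + 0 + + 4 * (+ 2 + μ + + 2 * σ + z * (+ 3 + μ + + 3 * σ))
    e₁ = solve-∀
    e₂ : ∀ μ σ z y → + 2 * (+ 1 + + 2 * z) + (+ 3 + (+ 1 + + 2 * μ) + + 3 * (+ 1 + + 2 * σ)) * + 0 + (+ 2 * (+ 1 + + 2 * μ) + + 1) * (+ 2 * y) ≡
         + 2 * (+ 1 + + 2 * z + (+ 3 + + 4 * μ) * y) + + 4 * + 0
    e₂ = solve-∀
    e₃ : ∀ μ σ y → + 3 * + 0 + (+ 1 + + 2 * μ + + 3 * (+ 1 + + 2 * σ)) * (+ 2 * y) ≡ + 0 + + 4 * ((+ 2 + μ + + 3 * σ) * y)
    e₃ = solve-∀

  pos-1+2* : ∀ n → + suc (2 ℕ.* n) ≡ + 1 + + 2 * + n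
  pos-1+2* n = cong (_+_ (+ 1)) (ℤ.pos-* 2 n)

  coeffs-even : ∀ μ σ → coeffs (2 ℕ.* μ) (2 ℕ.* σ) Mod2.≋ seq (+ 1) (+ 0) (+ 0) (+ 0)
  coeffs-even μ zero    = pointwise λ r → ≈-reflexive refl
    where open Mod2
  coeffs-even μ (suc σ) = subst (λ s → coeffs (2 ℕ.* μ) s ≋ seq (+ 1) (+ 0) (+ 0) (+ 0)) (sym (ℕ.*-suc 2 σ))
    (≋-trans (step-cong (+ (2 ℕ.* μ)) (+ suc (2 ℕ.* σ))
      (≋-trans (step-cong (+ (2 ℕ.* μ)) (+ (2 ℕ.* σ)) (coeffs-even μ σ))
        (even-step₁ (+ (2 ℕ.* μ)) (+ (2 ℕ.* σ)) (+ μ) (+ σ) (ℤ.pos-* 2 μ) (ℤ.pos-* 2 σ))))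
      (even-step₂ (+ (2 ℕ.* μ)) (+ suc (2 ℕ.* σ)) (+ μ) (+ σ) (ℤ.pos-* 2 μ) (pos-1+2* σ)))
    where open Mod2

  -- Half of the two-step cycle, kept apart because for odd m the iteration ends here, at s = m with
  -- σ = μ.
  coeffs-odd-suc : ∀ μ σ x y →
    coeffs (1 ℕ.+ 2 ℕ.* μ) (2 ℕ.* σ) Mod4.≋ seq (+ 1 + + 2 * x) (+ 0) (+ 2 * y) (+ 0) →
    coeffs (1 ℕ.+ 2 ℕ.* μ) (suc (2 ℕ.* σ)) Mod4.≋ seq (+ 2 * (+ 1 + + μ + + σ)) (+ 1 + + 2 * (x + y)) (+ 0) (+ 2 * y)
  coeffs-odd-suc μ σ x y c≋ = ≋-trans (step-cong (+ suc (2 ℕ.* μ)) (+ (2 ℕ.* σ)) c≋)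
    (odd-step₁ (+ suc (2 ℕ.* μ)) (+ (2 ℕ.* σ)) (+ μ) (+ σ) x y (pos-1+2* μ) (ℤ.pos-* 2 σ))
    where open Mod4

  coeffs-odd : ∀ μ σ → ∃ λ x → ∃ λ y →
    coeffs (1 ℕ.+ 2 ℕ.* μ) (2 ℕ.* σ) Mod4.≋ seq (+ 1 + + 2 * x) (+ 0) (+ 2 * y) (+ 0)
  coeffs-odd μ zero    = + 0 , + 0 , Mod4.pointwise initial
    where
    initial : ∀ r → coeffs (1 ℕ.+ 2 ℕ.* μ) 0 r Mod4.≈ seq (+ 1) (+ 0) (+ 0) (+ 0) r
    initial r = Mod4.≈-reflexive refl
  coeffs-odd μ (suc σ)
    with x , y , c≋ ← coeffs-odd μ σ
    with x′ , y′ , next ← odd-step₂ (+ suc (2 ℕ.* μ)) (+ suc (2 ℕ.* σ)) (+ μ) (+ σ) x y (pos-1+2* μ) (pos-1+2* σ) =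
    x′ , y′ , subst (λ s → coeffs (1 ℕ.+ 2 ℕ.* μ) s ≋ seq (+ 1 + + 2 * x′) (+ 0) (+ 2 * y′) (+ 0)) (sym (ℕ.*-suc 2 σ))
      (≋-trans (step-cong (+ suc (2 ℕ.* μ)) (+ suc (2 ℕ.* σ)) (coeffs-odd-suc μ σ x y c≋)) next)
    where open Mod4

  -- The power of 2 in `Q m 0 0`.

  1+2z-odd : ∀ z → ¬ 2 ℕ.∣ ∣ + 1 + + 2 * z ∣
  1+2z-odd z 2∣∣1+2z∣ with divides q 1+2z≡q*2 ← ∣ᵤ⇒∣ {+ 2} {+ 1 + + 2 * z} 2∣∣1+2z∣ =
    ℕ.>⇒∤ (ℕ.s≤s (ℕ.s≤s ℕ.z≤n))
      (ℕ.divides ∣ q + - z ∣ (trans (cong ∣_∣ (trans (isolate z) (trans (cong (_+ - (+ 2 * z)) 1+2z≡q*2) (collect q z)))) (ℤ.abs-* (q + - z) (+ 2))))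
    where
    isolate : ∀ z → + 1 ≡ + 1 + + 2 * z + - (+ 2 * z)
    isolate = solve-∀
    collect : ∀ q z → q * + 2 + - (+ 2 * z) ≡ (q + - z) * + 2
    collect = solve-∀

  Q-abs : ∀ m → Q m 0 0 ≡ 2 ℕ.^ m ℕ.* ∣ coeffs m m 0 ∣
  Q-abs m = trans (cong ∣_∣ (Q-eval m 0 0 m refl)) (ℤ.abs-* (+ (2 ℕ.^ m)) (coeffs m m 0))

  Q-even : ∀ μ → ∃ λ o → ¬ 2 ℕ.∣ o × Q (2 ℕ.* μ) 0 0 ≡ 2 ℕ.^ (2 ℕ.* μ) ℕ.* o
  Q-even μ with coeffs-even μ μ .Mod2._≋_.at 0
  ... | z Mod2., c₀≡ = _ , 1+2z-odd z , trans (Q-abs (2 ℕ.* μ)) (cong (λ c → 2 ℕ.^ (2 ℕ.* μ) ℕ.* ∣ c ∣) c₀≡)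

  -- At σ = μ entry 0 is congruent to 2 (1 + 2μ) modulo 4, hence twice an odd number; for other σ
  -- the factor 1 + μ + σ may be even.
  Q-odd : ∀ μ → ∃ λ o → ¬ 2 ℕ.∣ o × Q (1 ℕ.+ 2 ℕ.* μ) 0 0 ≡ 2 ℕ.^ (2 ℕ.+ 2 ℕ.* μ) ℕ.* o
  Q-odd μ with x , y , c≋ ← coeffs-odd μ μ with coeffs-odd-suc μ μ x y c≋ .Mod4._≋_.at 0
  ... | z Mod4., c₀≡ = _ , 1+2z-odd (+ μ + z) ,
    trans (Q-abs (1 ℕ.+ 2 ℕ.* μ)) (trans (cong (λ c → 2 ℕ.^ (1 ℕ.+ 2 ℕ.* μ) ℕ.* ∣ c ∣) (trans c₀≡ (factor (+ μ) z)))
      (trans (cong (2 ℕ.^ (1 ℕ.+ 2 ℕ.* μ) ℕ.*_) (ℤ.abs-* (+ 2) (+ 1 + + 2 * (+ μ + z))))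
      (trans (sym (ℕ.*-assoc (2 ℕ.^ (1 ℕ.+ 2 ℕ.* μ)) 2 _)) (cong (ℕ._* ∣ + 1 + + 2 * (+ μ + z) ∣) (ℕ.*-comm (2 ℕ.^ (1 ℕ.+ 2 ℕ.* μ)) 2)))))
    where
    factor : ∀ μ z → + 2 * (+ 1 + μ + μ) + + 4 * z ≡ + 2 * (+ 1 + + 2 * (μ + z))
    factor = solve-∀

open NewtonSeries using (Q-even; Q-odd)

open import Data.Nat using (_+_; _*_; _^_; _<_; s≤s; z≤n)
open import Data.Nat.Divisibility
  using (_∣_; divides; >⇒∤; ∣-trans; 1∣_; _∣0; m∣m*n; ∣m+n∣m⇒∣n; *-monoˡ-∣; *-monoʳ-∣; *-cancelˡ-∣)
open import Data.Nat.Primality using (euclidsLemma; prime[2])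
open import Data.Nat.Tactic.RingSolver using (solve-∀)

-- 2-adic orders and the conclusion.

*-odd : ∀ {m n} → ¬ 2 ∣ m → ¬ 2 ∣ n → ¬ 2 ∣ m * n
*-odd {m} {n} 2∤m 2∤n 2∣mn = [ 2∤m , 2∤n ]′ (euclidsLemma m n prime[2] 2∣mn)

1+2*-odd : ∀ n → ¬ 2 ∣ 1 + 2 * n
1+2*-odd n 2∣ = >⇒∤ (s≤s (s≤s z≤n)) (∣m+n∣m⇒∣n (subst (2 ∣_) (ℕ.+-comm 1 (2 * n)) 2∣) (m∣m*n n))

oddFactorial-odd : ∀ i → ¬ 2 ∣ oddFactorial i
oddFactorial-odd zero    = 1+2*-odd 0
oddFactorial-odd (suc i) = *-odd
  (subst (λ n → ¬ 2 ∣ n) (cong suc (ℕ.*-suc 2 i)) (1+2*-odd (suc i))) (oddFactorial-odd i)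

-- Euclid's lemma for the prime 2 peels the factors off `m` one at a time.
2^-cancel-odd : ∀ e {m n} → ¬ 2 ∣ n → 2 ^ e ∣ m * n → 2 ^ e ∣ m
2^-cancel-odd zero    {m}     2∤n _ = 1∣ m
2^-cancel-odd (suc e) {m} {n} 2∤n 2^∣mn
  with euclidsLemma m n prime[2] (∣-trans (m∣m*n (2 ^ e)) 2^∣mn)
... | inj₂ 2∣n = contradiction 2∣n 2∤n
... | inj₁ (divides q refl) = subst (2 ^ suc e ∣_) (ℕ.*-comm 2 q)
  (*-monoʳ-∣ 2 (2^-cancel-odd e {q} {n} 2∤n (*-cancelˡ-∣ 2 (subst (2 ^ suc e ∣_) (regroup q n) 2^∣mn))))
  where
  regroup : ∀ q n → q * 2 * n ≡ 2 * (q * n)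
  regroup = solve-∀

IsOrd₂-from-odd : ∀ e m n o → ¬ 2 ∣ n → ¬ 2 ∣ o → m * n ≡ 2 ^ e * o → IsOrd₂ m (fin e)
IsOrd₂-from-odd e m n o 2∤n 2∤o mn≡2^e*o =
  2^-cancel-odd e 2∤n (subst (2 ^ e ∣_) (sym mn≡2^e*o) (m∣m*n o)) ,
  λ 2^∣m → 2∤o (*-cancelˡ-∣ (2 ^ e) {{ℕ.m^n≢0 2 e}}
    (subst₂ _∣_ (ℕ.*-comm 2 (2 ^ e)) mn≡2^e*o (∣-trans 2^∣m (m∣m*n n))))

odd-part : ∀ {e k} → IsOrd₂ k (fin e) → ∃ λ o → ¬ 2 ∣ o × k ≡ 2 ^ e * o
odd-part {e} (divides o refl , 2^∤k) = o , (λ 2∣o → 2^∤k (*-monoˡ-∣ (2 ^ e) 2∣o)) , ℕ.*-comm o (2 ^ e)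

-- Excludes infinite order for positive k: 2ᵏ exceeds k and cannot divide it.
n<2^n : ∀ n → n < 2 ^ n
n<2^n zero    = s≤s z≤n
n<2^n (suc n) = ℕ.+-mono-≤ (ℕ.m^n>0 2 n) (ℕ.≤-trans (n<2^n n) (ℕ.m≤m+n (2 ^ n) 0))

data EvenOdd : ℕ → Set where
  even : ∀ n → EvenOdd (2 * n)
  odd  : ∀ n → EvenOdd (1 + 2 * n)

evenOdd : ∀ n → EvenOdd n
evenOdd zero    = even 0
evenOdd (suc n) with evenOdd n
... | even m = odd m
... | odd m  = subst EvenOdd (ℕ.*-suc 2 m) (even (suc m))

χₑ-even : ∀ n → χₑ (2 * n) ≡ 1
χₑ-even zero    = refl
χₑ-even (suc n) = trans (cong χₑ (ℕ.*-suc 2 n)) (χₑ-even n)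

χₑ-odd : ∀ n → χₑ (1 + 2 * n) ≡ 0
χₑ-odd zero    = refl
χₑ-odd (suc n) = trans (cong (λ m → χₑ (1 + m)) (ℕ.*-suc 2 n)) (χₑ-odd n)

-- The extra factor 2 for odd m is `χₑ (suc m)`, as m odd means k = m + 1 even.
Q-ord : ∀ m → ∃ λ o → ¬ 2 ∣ o × Q m 0 0 ≡ 2 ^ (m + χₑ (suc m)) * o
Q-ord m with evenOdd m
... | even μ = let o , 2∤o , Q≡ = Q-even μ in
  o , 2∤o , trans Q≡ (cong (λ e → 2 ^ e * o) (sym (trans (cong (2 * μ +_) (χₑ-odd μ)) (ℕ.+-identityʳ (2 * μ)))))
... | odd μ  = let o , 2∤o , Q≡ = Q-odd μ in
  o , 2∤o , trans Q≡ (cong (λ e → 2 ^ e * o) (sym (trans (cong (1 + 2 * μ +_) (trans (cong χₑ (sym (ℕ.*-suc 2 μ))) (χₑ-even (suc μ)))) (ℕ.+-comm (1 + 2 * μ) 1))))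

-- The factor 2k contributes e + 1 and `Q` contributes m + `χₑ k`; the 1 turns m into k. All double
-- factorials are odd.
tᵒ-ord : ∀ m e → IsOrd₂ (suc m) (fin e) → IsOrd₂ (tᵒ (4 * suc m + 1)) (fin (e + suc m + χₑ (suc m)))
tᵒ-ord m e ord
  with o , 2∤o , m+1≡ ← odd-part {e} ord
  with o′ , 2∤o′ , Q≡ ← Q-ord m =
  IsOrd₂-from-odd (e + suc m + χₑ (suc m)) (tᵒ (4 * suc m + 1)) (A m * B m) (Ω * (o * o′))
    (*-odd (*-odd (oddFactorial-odd m) (oddFactorial-odd (1 + 2 * m))) (oddFactorial-odd m))
    (*-odd (*-odd (oddFactorial-odd m) (oddFactorial-odd (2 + 2 * m))) (*-odd 2∤o 2∤o′))
    (begin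
      tᵒ (4 * suc m + 1) * (A m * B m)                       ≡⟨ tᵒ-formula m ⟩
      (2 + 2 * m) * Ω * Q m 0 0                              ≡⟨ cong (λ n → n * Ω * Q m 0 0) (ℕ.*-suc 2 m) ⟨
      2 * suc m * Ω * Q m 0 0                                ≡⟨ cong₂ (λ x y → 2 * x * Ω * y) m+1≡ Q≡ ⟩
      2 * (2 ^ e * o) * Ω * (2 ^ (m + χₑ (suc m)) * o′)      ≡⟨ regroup (2 ^ e) o Ω (2 ^ (m + χₑ (suc m))) o′ ⟩
      2 ^ e * 2 ^ (suc m + χₑ (suc m)) * (Ω * (o * o′))      ≡⟨ cong (_* (Ω * (o * o′))) (ℕ.^-distribˡ-+-* 2 e (suc m + χₑ (suc m))) ⟨
      2 ^ (e + (suc m + χₑ (suc m))) * (Ω * (o * o′))        ≡⟨ cong (λ n → 2 ^ n * (Ω * (o * o′))) (ℕ.+-assoc e (suc m) (χₑ (suc m))) ⟨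
      2 ^ (e + suc m + χₑ (suc m)) * (Ω * (o * o′))          ∎)
  where
  open ≡-Reasoning
  Ω = oddFactorial m * oddFactorial (2 + 2 * m)
  regroup : ∀ p o w q o′ → 2 * (p * o) * w * (q * o′) ≡ p * (2 * q) * (w * (o * o′))
  regroup = solve-∀

theorem5p5 : (k : ℕ) (v : ℕ∞) → IsOrd₂ k v →
    IsOrd₂ (tᵒ (4 * k + 1)) ((v +∞ k) +∞ χₑ k)
theorem5p5 zero    (fin e) (_ , 2^∤0) = contradiction ((2 ^ suc e) ∣0) 2^∤0
-- `tᵒ 1` evaluates to 0: the only involution of one point has no 2-cycle.
theorem5p5 zero    ∞       _          = λ e → (2 ^ e) ∣0
theorem5p5 (suc m) (fin e) ord        = tᵒ-ord m e ord
theorem5p5 (suc m) ∞       2^∣k       = contradiction (2^∣k (suc m)) (>⇒∤ (n<2^n (suc m)))
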